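{- Let $k=3$ and $r_1\ge r_2\ge r_3\ge 1$. If $(r_1-1)< (r_2-1)+(r_3-1)$, then the arithmetic mean component competitive ratio for the 3-objective time series search problem is $$z_f^3=\frac16\left\{\sqrt{4r_3+(r_1-r_2)^2}+(r_1+1)+(r_2+1)\right\}.$$
   Context: For an integer $k\ge 2$ and reals $0<m_i\le M_i$ ($1\le i\le k$), let $r_i=M_i/m_i$ be the fluctuation ratio of the price interval $[m_i,M_i]$ of the $i$th objective. It is assumed throughout that $r_1\ge\cdots\ge r_k\ge 1$. The arithmetic mean component competitive ratio of the $k$-objective time series search problem is the quantity $$z_f^k=\sup_{(x_1,\ldots,x_k)\in\mathcal{S}_f^k}\frac1k\left(\frac{M_1}{x_1}+\cdots+\frac{M_k}{x_k}\right),$$ where $$\mathcal{S}_f^k=\left\{(x_1,\ldots,x_k)\in[m_1,M_1]\times\cdots\times[m_k,M_k] : \frac1k\sum_{i=1}^k\frac{x_i}{m_i}=\frac1k\sum_{i=1}^k\frac{M_i}{x_i}\right\}.$$ -}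

module Defs where

open import Data.Nat.Base as ℕ using (ℕ; zero; suc)
import Data.Nat.Properties as ℕ
import Data.Nat.DivMod as ℕ
import Data.Nat.Tactic.RingSolver as ℕSolver
open import Data.Integer.Base as ℤ using (+_)
import Data.Integer.Properties as ℤ
open import Data.Rational.Base as ℚ using (ℚ; 0ℚ; 1ℚ; ½; mkℚ; toℚᵘ; ↥_; ↧_; ↧ₙ_)
import Data.Rational.Properties as ℚ
open import Data.Rational.Solver using (module +-*-Solver)
open import Data.Rational.Unnormalised.Base as ℚᵘ using (mkℚᵘ)
import Data.Rational.Unnormalised.Properties as ℚᵘ
open import Data.Fin.Base using (Fin)
open import Data.Vec.Functional using (foldr)
open import Data.Product using (∃-syntax; Σ-syntax; _×_; _,_; proj₁; proj₂)
open import Data.Sum.Base using (inj₁; inj₂)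
open import Relation.Nullary using (yes; no; contradiction)
open import Relation.Binary.PropositionalEquality

------------------------------------------------------------------------
-- Facts about rationals

*-mono-≤-nonNeg : ∀ {p q r s} → 0ℚ ℚ.≤ r → 0ℚ ℚ.≤ q → p ℚ.≤ q → r ℚ.≤ s → p ℚ.* r ℚ.≤ q ℚ.* s
*-mono-≤-nonNeg {p} {q} {r} {s} 0≤r 0≤q p≤q r≤s = ℚ.≤-trans
  (ℚ.*-monoʳ-≤-nonNeg r {{ℚ.nonNegative 0≤r}} p≤q)
  (ℚ.*-monoˡ-≤-nonNeg q {{ℚ.nonNegative 0≤q}} r≤s)

*-pos : ∀ {p q} → 0ℚ ℚ.< p → 0ℚ ℚ.< q → 0ℚ ℚ.< p ℚ.* q
*-pos {p} {q} 0<p 0<q = ℚ.positive⁻¹ (p ℚ.* q)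
  {{ℚ.pos*pos⇒pos p {{ℚ.positive 0<p}} q {{ℚ.positive 0<q}}}}

0<½ : 0ℚ ℚ.< ½
0<½ = ℚ.positive⁻¹ ½

½*-pos : ∀ {ε} → 0ℚ ℚ.< ε → 0ℚ ℚ.< ½ ℚ.* ε
½*-pos = *-pos 0<½

½+½ : ∀ ε → ½ ℚ.* ε ℚ.+ ½ ℚ.* ε ≡ ε
½+½ ε = trans (sym (ℚ.*-distribʳ-+ ε ½ ½)) (ℚ.*-identityˡ ε)

p≤∣p∣ : ∀ p → p ℚ.≤ ℚ.∣ p ∣
p≤∣p∣ p with ℚ.≤-total 0ℚ p
... | inj₁ 0≤p = ℚ.≤-reflexive (sym (ℚ.0≤p⇒∣p∣≡p 0≤p))
... | inj₂ p≤0 = ℚ.≤-trans p≤0 (ℚ.0≤∣p∣ p)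

∣p-q∣≡∣q-p∣ : ∀ p q → ℚ.∣ p ℚ.- q ∣ ≡ ℚ.∣ q ℚ.- p ∣
∣p-q∣≡∣q-p∣ p q = trans
  (cong ℚ.∣_∣ (solve 2 (λ p q → p :- q := :- (q :- p)) refl p q))
  (ℚ.∣-p∣≡∣p∣ (q ℚ.- p))
  where open +-*-Solver

∣p-q∣≤r⇒p≤q+r : ∀ {p q r} → ℚ.∣ p ℚ.- q ∣ ℚ.≤ r → p ℚ.≤ q ℚ.+ r
∣p-q∣≤r⇒p≤q+r {p} {q} {r} h = ℚ.≤-trans
  (ℚ.≤-reflexive (solve 2 (λ p q → p := q :+ (p :- q)) refl p q))
  (ℚ.+-monoʳ-≤ q (ℚ.≤-trans (p≤∣p∣ (p ℚ.- q)) h))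
  where open +-*-Solver

∣∣-≤ : ∀ {p r} → p ℚ.≤ r → ℚ.- p ℚ.≤ r → ℚ.∣ p ∣ ℚ.≤ r
∣∣-≤ {p} {r} p≤r -p≤r with ℚ.∣p∣≡p∨∣p∣≡-p p
... | inj₁ e = subst (ℚ._≤ r) (sym e) p≤r
... | inj₂ e = subst (ℚ._≤ r) (sym e) -p≤r

p≤q+r⇒p-q≤r : ∀ {p q r} → p ℚ.≤ q ℚ.+ r → p ℚ.- q ℚ.≤ r
p≤q+r⇒p-q≤r {p} {q} {r} h = ℚ.≤-trans (ℚ.+-monoˡ-≤ (ℚ.- q) h)
  (ℚ.≤-reflexive (solve 2 (λ q r → (q :+ r) :- q := r) refl q r))
  where open +-*-Solver

∣p-q∣≤r : ∀ {p q r} → p ℚ.≤ q ℚ.+ r → q ℚ.≤ p ℚ.+ r → ℚ.∣ p ℚ.- q ∣ ℚ.≤ r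
∣p-q∣≤r {p} {q} {r} h₁ h₂ = ∣∣-≤ (p≤q+r⇒p-q≤r h₁)
  (subst (ℚ._≤ r) (solve 2 (λ p q → q :- p := :- (p :- q)) refl p q) (p≤q+r⇒p-q≤r h₂))
  where open +-*-Solver

invℚ : ℚ → ℚ
invℚ q with q ℚ.≟ 0ℚ
... | yes _   = 0ℚ
... | no q≢0 = (ℚ.1/ q) {{ℚ.≢-nonZero q≢0}}

invℚ-inverseʳ : ∀ {q} → 0ℚ ℚ.< q → q ℚ.* invℚ q ≡ 1ℚ
invℚ-inverseʳ {q} 0<q with q ℚ.≟ 0ℚ
... | yes q≡0 = contradiction (sym q≡0) (ℚ.<⇒≢ 0<q)
... | no q≢0 = ℚ.*-inverseʳ q {{ℚ.≢-nonZero q≢0}}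

invℚ-pos : ∀ {q} → 0ℚ ℚ.< q → 0ℚ ℚ.< invℚ q
invℚ-pos {q} 0<q with q ℚ.≟ 0ℚ
... | yes q≡0 = contradiction (sym q≡0) (ℚ.<⇒≢ 0<q)
... | no q≢0 = ℚ.positive⁻¹ _ {{ℚ.1/pos⇒pos q {{ℚ.positive 0<q}}}}

invℚ-anti : ∀ {c a} → 0ℚ ℚ.< c → c ℚ.≤ a → invℚ a ℚ.≤ invℚ c
invℚ-anti {c} {a} 0<c c≤a = subst₂ ℚ._≤_ e₁ e₂
  (*-mono-≤-nonNeg (ℚ.<⇒≤ (invℚ-pos 0<c)) (ℚ.<⇒≤ (*-pos (invℚ-pos 0<a) 0<a))
    (ℚ.*-monoˡ-≤-nonNeg (invℚ a) {{ℚ.nonNegative (ℚ.<⇒≤ (invℚ-pos 0<a))}} c≤a)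
    ℚ.≤-refl)
  where
  0<a = ℚ.<-≤-trans 0<c c≤a
  e₁ : invℚ a ℚ.* c ℚ.* invℚ c ≡ invℚ a
  e₁ = trans (ℚ.*-assoc (invℚ a) c (invℚ c))
       (trans (cong (invℚ a ℚ.*_) (invℚ-inverseʳ 0<c)) (ℚ.*-identityʳ _))
  e₂ : invℚ a ℚ.* a ℚ.* invℚ c ≡ invℚ c
  e₂ = trans (cong (ℚ._* invℚ c) (trans (ℚ.*-comm (invℚ a) a) (invℚ-inverseʳ 0<a)))
       (ℚ.*-identityˡ _)

------------------------------------------------------------------------
-- Rational approximation of square roots

-- ⌊√n⌋
isqrt : ℕ → ℕ
isqrt zero    = 0
isqrt (suc n) with suc (isqrt n) ℕ.* suc (isqrt n) ℕ.≤? suc n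
... | yes _ = suc (isqrt n)
... | no  _ = isqrt n

-- ⌊N√q⌋ / N for q ≥ 0, where N = n + 1.
sqrtℚ : ℕ → ℚ → ℚ
sqrtℚ n q = + isqrt ((ℤ.∣ ↥ q ∣ ℕ.* (suc n ℕ.* suc n)) ℕ./ ↧ₙ q) ℚ./ suc n

isqrt-lower : ∀ n → isqrt n ℕ.* isqrt n ℕ.≤ n
isqrt-lower zero = ℕ.z≤n
isqrt-lower (suc n) with suc (isqrt n) ℕ.* suc (isqrt n) ℕ.≤? suc n
... | yes h = h
... | no  _ = ℕ.≤-trans (isqrt-lower n) (ℕ.n≤1+n n)

isqrt-upper : ∀ n → n ℕ.< suc (isqrt n) ℕ.* suc (isqrt n)
isqrt-upper zero = ℕ.s≤s ℕ.z≤n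
isqrt-upper (suc n) with suc (isqrt n) ℕ.* suc (isqrt n) ℕ.≤? suc n
... | yes _ = ℕ.≤-<-trans (isqrt-upper n)
  (ℕ.*-mono-< (ℕ.n<1+n (suc (isqrt n))) (ℕ.n<1+n (suc (isqrt n))))
... | no  h = ℕ.≰⇒> h

1/suc : ℕ → ℚ
1/suc n = + 1 ℚ./ suc n

0≤1/suc : ∀ n → 0ℚ ℚ.≤ 1/suc n
0≤1/suc n = ℚ.nonNegative⁻¹ (1/suc n) {{ℚ.normalize-nonNeg 1 (suc n)}}

0≤sqrtℚ : ∀ n q → 0ℚ ℚ.≤ sqrtℚ n q
0≤sqrtℚ n q = ℚ.nonNegative⁻¹ (sqrtℚ n q)
  {{ℚ.normalize-nonNeg (isqrt ((ℤ.∣ ↥ q ∣ ℕ.* (suc n ℕ.* suc n)) ℕ./ ↧ₙ q)) (suc n)}}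

toℚᵘ-/ : ∀ a n → toℚᵘ (+ a ℚ./ suc n) ℚᵘ.≃ mkℚᵘ (+ a) n
toℚᵘ-/ a n = ℚ.toℚᵘ-fromℚᵘ (mkℚᵘ (+ a) n)

sqrtℚ-suc : ∀ n q → sqrtℚ n q ℚ.+ 1/suc n ≡
  + suc (isqrt ((ℤ.∣ ↥ q ∣ ℕ.* (suc n ℕ.* suc n)) ℕ./ ↧ₙ q)) ℚ./ suc n
sqrtℚ-suc n q = ℚ.toℚᵘ-injective (ℚᵘ.≃-trans (ℚ.toℚᵘ-homo-+ (sqrtℚ n q) (1/suc n))
  (ℚᵘ.≃-trans (ℚᵘ.+-cong (toℚᵘ-/ a n) (toℚᵘ-/ 1 n))
  (ℚᵘ.≃-trans (ℚᵘ.*≡* lem) (ℚᵘ.≃-sym (toℚᵘ-/ (suc a) n)))))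
  where
  a = isqrt ((ℤ.∣ ↥ q ∣ ℕ.* (suc n ℕ.* suc n)) ℕ./ ↧ₙ q)
  lemℕ : ∀ a N → (a ℕ.* N ℕ.+ 1 ℕ.* N) ℕ.* N ≡ suc a ℕ.* (N ℕ.* N)
  lemℕ = ℕSolver.solve-∀
  lem : (+ a ℤ.* + suc n ℤ.+ + 1 ℤ.* + suc n) ℤ.* + suc n ≡ + suc a ℤ.* + (suc n ℕ.* suc n)
  lem = trans (cong (ℤ._* + suc n)
          (cong₂ ℤ._+_ (sym (ℤ.pos-* a (suc n))) (sym (ℤ.pos-* 1 (suc n)))))
        (trans (sym (ℤ.pos-* (a ℕ.* suc n ℕ.+ 1 ℕ.* suc n) (suc n)))
        (trans (cong +_ (lemℕ a (suc n))) (ℤ.pos-* (suc a) (suc n ℕ.* suc n))))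

toℚᵘ-sq : ∀ a n → toℚᵘ ((+ a ℚ./ suc n) ℚ.* (+ a ℚ./ suc n)) ℚᵘ.≃ mkℚᵘ (+ a) n ℚᵘ.* mkℚᵘ (+ a) n
toℚᵘ-sq a n = ℚᵘ.≃-trans (ℚ.toℚᵘ-homo-* (+ a ℚ./ suc n) (+ a ℚ./ suc n))
  (ℚᵘ.*-cong (toℚᵘ-/ a n) (toℚᵘ-/ a n))

sqrtℚ-lower : ∀ n {q} → 0ℚ ℚ.≤ q → sqrtℚ n q ℚ.* sqrtℚ n q ℚ.≤ q
sqrtℚ-lower n {q@(mkℚ (+ p) d-1 _)} 0≤q = ℚ.toℚᵘ-cancel-≤
  (ℚᵘ.≤-respˡ-≃ (ℚᵘ.≃-sym (toℚᵘ-sq a n)) (ℚᵘ.*≤*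
    (subst₂ ℤ._≤_ e₁ (ℤ.pos-* p (N ℕ.* N)) (ℤ.+≤+ lemℕ))))
  where
  N = suc n
  d = suc d-1
  a = isqrt ((p ℕ.* (N ℕ.* N)) ℕ./ d)
  lemℕ : a ℕ.* a ℕ.* d ℕ.≤ p ℕ.* (N ℕ.* N)
  lemℕ = ℕ.≤-trans (ℕ.*-monoˡ-≤ d (isqrt-lower ((p ℕ.* (N ℕ.* N)) ℕ./ d)))
    (ℕ.m/n*n≤m (p ℕ.* (N ℕ.* N)) d)
  e₁ : + (a ℕ.* a ℕ.* d) ≡ + a ℤ.* + a ℤ.* + d
  e₁ = trans (ℤ.pos-* (a ℕ.* a) d) (cong (ℤ._* + d) (ℤ.pos-* a a))
sqrtℚ-lower n {mkℚ ℤ.-[1+ _ ] _ _} (ℚ.*≤* ())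

sqrtℚ-upper : ∀ n {q} → 0ℚ ℚ.≤ q → q ℚ.< (sqrtℚ n q ℚ.+ 1/suc n) ℚ.* (sqrtℚ n q ℚ.+ 1/suc n)
sqrtℚ-upper n {q@(mkℚ (+ p) d-1 _)} 0≤q = subst (λ s → q ℚ.< s ℚ.* s) (sym (sqrtℚ-suc n q))
  (ℚ.toℚᵘ-cancel-< (ℚᵘ.<-respʳ-≃ (ℚᵘ.≃-sym (toℚᵘ-sq (suc a) n)) (ℚᵘ.*<*
    (subst₂ ℤ._<_ (ℤ.pos-* p (N ℕ.* N)) e₁ (ℤ.+<+ lemℕ)))))
  where
  N = suc n
  d = suc d-1
  X = p ℕ.* (N ℕ.* N)
  a = isqrt (X ℕ./ d)
  lemℕ : X ℕ.< suc a ℕ.* suc a ℕ.* d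
  lemℕ = ℕ.<-≤-trans (subst (ℕ._< suc (X ℕ./ d) ℕ.* d) (sym (ℕ.m≡m%n+[m/n]*n X d))
      (ℕ.+-monoˡ-< (X ℕ./ d ℕ.* d) (ℕ.m%n<n X d)))
    (ℕ.*-monoˡ-≤ d (isqrt-upper (X ℕ./ d)))
  e₁ : + (suc a ℕ.* suc a ℕ.* d) ≡ + suc a ℤ.* + suc a ℤ.* + d
  e₁ = trans (ℤ.pos-* (suc a ℕ.* suc a) d) (cong (ℤ._* + d) (ℤ.pos-* (suc a) (suc a)))
sqrtℚ-upper n {mkℚ ℤ.-[1+ _ ] _ _} (ℚ.*≤* ())

sq-cancel-≤ : ∀ {s w u v ε} → 0ℚ ℚ.≤ s → 0ℚ ℚ.≤ w → 0ℚ ℚ.≤ ε →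
  s ℚ.* s ℚ.≤ u → u ℚ.≤ v ℚ.+ ε ℚ.* ε → v ℚ.< w ℚ.* w → s ℚ.≤ w ℚ.+ ε
sq-cancel-≤ {s} {w} {u} {v} {ε} 0≤s 0≤w 0≤ε s²≤u u≤v+ε² v<w² with s ℚ.≤? w ℚ.+ ε
... | yes h = h
... | no  h = contradiction
  (ℚ.<-≤-trans (ℚ.≤-<-trans u≤v+ε² (ℚ.+-monoˡ-< (ε ℚ.* ε) v<w²))
    (ℚ.≤-trans w²+ε²≤ (ℚ.≤-trans (*-mono-≤-nonNeg 0≤w+ε 0≤s w+ε≤s w+ε≤s) s²≤u)))
  (ℚ.<-irrefl refl)
  where
  0≤w+ε : 0ℚ ℚ.≤ w ℚ.+ ε
  0≤w+ε = subst (ℚ._≤ w ℚ.+ ε) (ℚ.+-identityˡ 0ℚ) (ℚ.+-mono-≤ 0≤w 0≤ε)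
  w+ε≤s : w ℚ.+ ε ℚ.≤ s
  w+ε≤s = ℚ.<⇒≤ (ℚ.≰⇒> h)
  0≤wε : 0ℚ ℚ.≤ w ℚ.* ε
  0≤wε = subst (ℚ._≤ w ℚ.* ε) (ℚ.*-zeroˡ 0ℚ) (*-mono-≤-nonNeg ℚ.≤-refl 0≤w 0≤w 0≤ε)
  w²+ε²≤ : w ℚ.* w ℚ.+ ε ℚ.* ε ℚ.≤ (w ℚ.+ ε) ℚ.* (w ℚ.+ ε)
  w²+ε²≤ = subst₂ ℚ._≤_
    (trans (cong (w ℚ.* w ℚ.+ ε ℚ.* ε ℚ.+_) (ℚ.+-identityˡ 0ℚ)) (ℚ.+-identityʳ _))
    (solve 2 (λ w e → (w :* w :+ e :* e) :+ (w :* e :+ w :* e) := (w :+ e) :* (w :+ e)) refl w ε)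
    (ℚ.+-monoʳ-≤ (w ℚ.* w ℚ.+ ε ℚ.* ε) (ℚ.+-mono-≤ 0≤wε 0≤wε))
    where open +-*-Solver

sqrtℚ-close : ∀ m n {u v ε} → 0ℚ ℚ.≤ u → 0ℚ ℚ.≤ v → 0ℚ ℚ.≤ ε → u ℚ.≤ v ℚ.+ ε ℚ.* ε →
  sqrtℚ m u ℚ.≤ sqrtℚ n v ℚ.+ (1/suc n ℚ.+ ε)
sqrtℚ-close m n {u} {v} {ε} 0≤u 0≤v 0≤ε u≤v+ε² =
  subst (sqrtℚ m u ℚ.≤_) (ℚ.+-assoc (sqrtℚ n v) (1/suc n) ε)
    (sq-cancel-≤ {sqrtℚ m u} {sqrtℚ n v ℚ.+ 1/suc n} (0≤sqrtℚ m u)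
      (subst (ℚ._≤ sqrtℚ n v ℚ.+ 1/suc n) (ℚ.+-identityˡ 0ℚ) (ℚ.+-mono-≤ (0≤sqrtℚ n v) (0≤1/suc n)))
      0≤ε (sqrtℚ-lower m 0≤u) u≤v+ε² (sqrtℚ-upper n 0≤v))

archimedean : ∀ {ε} → 0ℚ ℚ.< ε → ∃[ N ] ∀ n → N ℕ.≤ n → 1/suc n ℚ.≤ ε
archimedean {mkℚ ℤ.+[1+ p ] d _} _ = d , λ n d≤n → ℚ.toℚᵘ-cancel-≤
  (ℚᵘ.≤-respˡ-≃ (ℚᵘ.≃-sym (toℚᵘ-/ 1 n)) (ℚᵘ.*≤* (subst₂ ℤ._≤_ (ℤ.pos-* 1 (suc d)) (ℤ.pos-* (suc p) (suc n))
    (ℤ.+≤+ (ℕ.*-mono-≤ (ℕ.s≤s (ℕ.z≤n {p})) (ℕ.s≤s d≤n))))))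
archimedean {mkℚ (+ 0) _ _} (ℚ.*<* (ℤ.+<+ ()))
archimedean {mkℚ ℤ.-[1+ _ ] _ _} (ℚ.*<* ())

------------------------------------------------------------------------
-- Real numbers, as Cauchy sequences of rationals modulo _≈_

Eventually : (ℕ → Set) → Set
Eventually P = ∃[ N ] ∀ n → N ℕ.≤ n → P n

infixr 5 _∧ᵉ_

_∧ᵉ_ : ∀ {P Q} → Eventually P → Eventually Q → Eventually (λ n → P n × Q n)
(M , p) ∧ᵉ (N , q) = M ℕ.⊔ N , λ n h →
  p n (ℕ.≤-trans (ℕ.m≤m⊔n M N) h) , q n (ℕ.≤-trans (ℕ.m≤n⊔m M N) h)

IsCauchy : (ℕ → ℚ) → Set
IsCauchy x = ∀ ε → 0ℚ ℚ.< ε → ∃[ N ] ∀ m n → N ℕ.≤ m → N ℕ.≤ n → ℚ.∣ x m ℚ.- x n ∣ ℚ.≤ ε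

record ℝ : Set where
  constructor mkℝ
  field
    seq    : ℕ → ℚ
    cauchy : IsCauchy seq

open ℝ public

infix 4 _≈_ _≤_ _<_

record _≈_ (x y : ℝ) : Set where
  constructor mk≈
  field ≈-bound : ∀ ε → 0ℚ ℚ.< ε → Eventually λ n → ℚ.∣ seq x n ℚ.- seq y n ∣ ℚ.≤ ε

record _≤_ (x y : ℝ) : Set where
  constructor mk≤
  field ≤-bound : ∀ ε → 0ℚ ℚ.< ε → Eventually λ n → seq x n ℚ.≤ seq y n ℚ.+ ε

record _<_ (x y : ℝ) : Set where
  constructor mk<
  field
    gap     : ℚ
    0<gap   : 0ℚ ℚ.< gap
    <-bound : Eventually λ n → seq x n ℚ.+ gap ℚ.≤ seq y n

open _≈_ public
open _≤_ public
open _<_ public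

fromℚ : ℚ → ℝ
fromℚ q = mkℝ (λ _ → q) λ ε 0<ε → 0 , λ _ _ _ _ →
  subst (λ p → ℚ.∣ p ∣ ℚ.≤ ε) (sym (ℚ.+-inverseʳ q)) (ℚ.<⇒≤ 0<ε)

0ℝ 1ℝ : ℝ
0ℝ = fromℚ 0ℚ
1ℝ = fromℚ 1ℚ

<-≤-trans : ∀ {x y z} → x < y → y ≤ z → x < z
<-≤-trans {x} {y} {z} (mk< ε 0<ε x<y) y≤z = mk< (½ ℚ.* ε) (½*-pos 0<ε) (proj₁ both , λ n N≤n →
  let (h₁ , h₂) = proj₂ both n N≤n in
  subst₂ ℚ._≤_ (lem₁ (seq x n)) (lem₂ (seq z n)) (ℚ.+-monoˡ-≤ (ℚ.- (½ ℚ.* ε)) (ℚ.≤-trans h₁ h₂)))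
  where
  open +-*-Solver
  both : Eventually λ n → seq x n ℚ.+ ε ℚ.≤ seq y n × seq y n ℚ.≤ seq z n ℚ.+ ½ ℚ.* ε
  both = x<y ∧ᵉ ≤-bound y≤z (½ ℚ.* ε) (½*-pos 0<ε)
  lem₁ : ∀ p → p ℚ.+ ε ℚ.- ½ ℚ.* ε ≡ p ℚ.+ ½ ℚ.* ε
  lem₁ p = trans (cong (λ e → p ℚ.+ e ℚ.- ½ ℚ.* ε) (sym (½+½ ε)))
    (solve 2 (λ p e → (p :+ (e :+ e)) :- e := p :+ e) refl p (½ ℚ.* ε))
  lem₂ : ∀ p → p ℚ.+ ½ ℚ.* ε ℚ.- ½ ℚ.* ε ≡ p
  lem₂ p = solve 2 (λ p e → (p :+ e) :- e := p) refl p (½ ℚ.* ε)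

bounded : ∀ x → ∃[ B ] 0ℚ ℚ.< B × Eventually λ n → ℚ.∣ seq x n ∣ ℚ.≤ B
bounded x with cauchy x 1ℚ (ℚ.positive⁻¹ 1ℚ)
... | N , h = ℚ.∣ seq x N ∣ ℚ.+ 1ℚ , ℚ.+-mono-≤-< (ℚ.0≤∣p∣ (seq x N)) (ℚ.positive⁻¹ 1ℚ) , N , λ n N≤n →
  ℚ.≤-trans
    (ℚ.≤-trans (ℚ.≤-reflexive (cong ℚ.∣_∣ (solve 2 (λ p q → p := q :+ (p :- q)) refl (seq x n) (seq x N))))
      (ℚ.∣p+q∣≤∣p∣+∣q∣ (seq x N) (seq x n ℚ.- seq x N)))
    (ℚ.+-monoʳ-≤ ℚ.∣ seq x N ∣ (h n N N≤n ℕ.≤-refl))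
  where open +-*-Solver

infix  8 -_
infixl 7 _*_
infixl 6 _+_ _-_
infix  7 _÷_[_]

_+_ : ℝ → ℝ → ℝ
x + y = mkℝ (λ n → seq x n ℚ.+ seq y n) λ ε 0<ε →
  let (M , p) = cauchy x (½ ℚ.* ε) (½*-pos 0<ε)
      (N , q) = cauchy y (½ ℚ.* ε) (½*-pos 0<ε)
  in M ℕ.⊔ N , λ m n hm hn →
    subst₂ ℚ._≤_ (cong ℚ.∣_∣ (lem (seq x m) (seq x n) (seq y m) (seq y n))) (½+½ ε)
      (ℚ.≤-trans (ℚ.∣p+q∣≤∣p∣+∣q∣ (seq x m ℚ.- seq x n) (seq y m ℚ.- seq y n))
        (ℚ.+-mono-≤ (p m n (ℕ.≤-trans (ℕ.m≤m⊔n M N) hm) (ℕ.≤-trans (ℕ.m≤m⊔n M N) hn))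
                    (q m n (ℕ.≤-trans (ℕ.m≤n⊔m M N) hm) (ℕ.≤-trans (ℕ.m≤n⊔m M N) hn))))
  where
  open +-*-Solver
  lem : ∀ a b c d → (a ℚ.- b) ℚ.+ (c ℚ.- d) ≡ (a ℚ.+ c) ℚ.- (b ℚ.+ d)
  lem = solve 4 (λ a b c d → (a :- b) :+ (c :- d) := (a :+ c) :- (b :+ d)) refl

-_ : ℝ → ℝ
- x = mkℝ (λ n → ℚ.- seq x n) λ ε 0<ε →
  let (N , p) = cauchy x ε 0<ε in
  N , λ m n hm hn → subst (ℚ._≤ ε) (cong ℚ.∣_∣ (lem (seq x m) (seq x n))) (p n m hn hm)
  where
  open +-*-Solver
  lem : ∀ a b → b ℚ.- a ≡ ℚ.- a ℚ.- ℚ.- b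
  lem = solve 2 (λ a b → b :- a := (:- a) :- (:- b)) refl

_-_ : ℝ → ℝ → ℝ
x - y = x + - y

_*_ : ℝ → ℝ → ℝ
x * y = mkℝ (λ n → seq x n ℚ.* seq y n) λ ε 0<ε →
  let (A , 0<A , M₁ , a) = bounded x
      (B , 0<B , M₂ , b) = bounded y
      (N₁ , p) = cauchy x (½ ℚ.* ε ℚ.* invℚ B) (*-pos (½*-pos 0<ε) (invℚ-pos 0<B))
      (N₂ , q) = cauchy y (½ ℚ.* ε ℚ.* invℚ A) (*-pos (½*-pos 0<ε) (invℚ-pos 0<A))
      N = (M₁ ℕ.⊔ M₂) ℕ.⊔ (N₁ ℕ.⊔ N₂)
      M₁≤N = ℕ.≤-trans (ℕ.m≤m⊔n M₁ M₂) (ℕ.m≤m⊔n (M₁ ℕ.⊔ M₂) (N₁ ℕ.⊔ N₂))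
      M₂≤N = ℕ.≤-trans (ℕ.m≤n⊔m M₁ M₂) (ℕ.m≤m⊔n (M₁ ℕ.⊔ M₂) (N₁ ℕ.⊔ N₂))
      N₁≤N = ℕ.≤-trans (ℕ.m≤m⊔n N₁ N₂) (ℕ.m≤n⊔m (M₁ ℕ.⊔ M₂) (N₁ ℕ.⊔ N₂))
      N₂≤N = ℕ.≤-trans (ℕ.m≤n⊔m N₁ N₂) (ℕ.m≤n⊔m (M₁ ℕ.⊔ M₂) (N₁ ℕ.⊔ N₂))
  in N , λ m n hm hn →
    let xm = seq x m ; xn = seq x n ; ym = seq y m ; yn = seq y n
        t₁ = subst₂ ℚ._≤_ (sym (ℚ.∣p*q∣≡∣p∣*∣q∣ xm (ym ℚ.- yn))) (cancel ε 0<A)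
               (*-mono-≤-nonNeg (ℚ.0≤∣p∣ (ym ℚ.- yn)) (ℚ.<⇒≤ 0<A)
                 (a m (ℕ.≤-trans M₁≤N hm))
                 (q m n (ℕ.≤-trans N₂≤N hm) (ℕ.≤-trans N₂≤N hn)))
        t₂ = subst₂ ℚ._≤_ (sym (ℚ.∣p*q∣≡∣p∣*∣q∣ yn (xm ℚ.- xn))) (cancel ε 0<B)
               (*-mono-≤-nonNeg (ℚ.0≤∣p∣ (xm ℚ.- xn)) (ℚ.<⇒≤ 0<B)
                 (b n (ℕ.≤-trans M₂≤N hn))
                 (p m n (ℕ.≤-trans N₁≤N hm) (ℕ.≤-trans N₁≤N hn)))
    in subst₂ ℚ._≤_ (cong ℚ.∣_∣ (split xm xn ym yn)) (½+½ ε)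
      (ℚ.≤-trans (ℚ.∣p+q∣≤∣p∣+∣q∣ (xm ℚ.* (ym ℚ.- yn)) (yn ℚ.* (xm ℚ.- xn))) (ℚ.+-mono-≤ t₁ t₂))
  where
  open +-*-Solver
  split : ∀ a b c d → a ℚ.* (c ℚ.- d) ℚ.+ d ℚ.* (a ℚ.- b) ≡ a ℚ.* c ℚ.- b ℚ.* d
  split = solve 4 (λ a b c d → a :* (c :- d) :+ d :* (a :- b) := a :* c :- b :* d) refl
  cancel : ∀ ε {A} → 0ℚ ℚ.< A → A ℚ.* (½ ℚ.* ε ℚ.* invℚ A) ≡ ½ ℚ.* ε
  cancel ε {A} 0<A = trans
    (solve 3 (λ a e i → a :* (e :* i) := (a :* i) :* e) refl A (½ ℚ.* ε) (invℚ A))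
    (trans (cong (ℚ._* (½ ℚ.* ε)) (invℚ-inverseʳ 0<A)) (ℚ.*-identityˡ (½ ℚ.* ε)))

-- The proof of positivity only enters through the modulus of convergence.
inv : (x : ℝ) → 0ℝ < x → ℝ
inv x (mk< c 0<c (N₀ , c≤x)) = mkℝ (λ n → invℚ (seq x n)) λ ε 0<ε →
  let (N₁ , p) = cauchy x (c ℚ.* c ℚ.* ε) (*-pos (*-pos 0<c 0<c) 0<ε)
      N₀≤N = ℕ.m≤m⊔n N₀ N₁
      N₁≤N = ℕ.m≤n⊔m N₀ N₁
  in N₀ ℕ.⊔ N₁ , λ m n hm hn →
    let c≤xm = c≤ m (ℕ.≤-trans N₀≤N hm)
        c≤xn = c≤ n (ℕ.≤-trans N₀≤N hn)
        a = invℚ (seq x m) ; b = invℚ (seq x n)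
        0≤a = ℚ.<⇒≤ (invℚ-pos (ℚ.<-≤-trans 0<c c≤xm))
        0≤b = ℚ.<⇒≤ (invℚ-pos (ℚ.<-≤-trans 0<c c≤xn))
        0≤i = ℚ.<⇒≤ (invℚ-pos 0<c)
        d = seq x n ℚ.- seq x m
    in subst₂ ℚ._≤_
      (trans (cong (ℚ._* ℚ.∣ d ∣) (sym (ℚ.0≤p⇒∣p∣≡p (0≤* 0≤a 0≤b))))
        (trans (sym (ℚ.∣p*q∣≡∣p∣*∣q∣ (a ℚ.* b) d))
          (cong ℚ.∣_∣ (diff (ℚ.<-≤-trans 0<c c≤xm) (ℚ.<-≤-trans 0<c c≤xn)))))
      (cancel ε)
      (*-mono-≤-nonNeg (ℚ.0≤∣p∣ d) (0≤* 0≤i 0≤i)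
        (*-mono-≤-nonNeg 0≤b 0≤i (invℚ-anti 0<c c≤xm) (invℚ-anti 0<c c≤xn))
        (p n m (ℕ.≤-trans N₁≤N hn) (ℕ.≤-trans N₁≤N hm)))
  where
  open +-*-Solver
  0≤* : ∀ {p q} → 0ℚ ℚ.≤ p → 0ℚ ℚ.≤ q → 0ℚ ℚ.≤ p ℚ.* q
  0≤* {p} {q} h k = subst (ℚ._≤ p ℚ.* q) (ℚ.*-zeroˡ 0ℚ) (*-mono-≤-nonNeg ℚ.≤-refl h h k)
  c≤ : ∀ n → N₀ ℕ.≤ n → c ℚ.≤ seq x n
  c≤ n h = subst (ℚ._≤ seq x n) (ℚ.+-identityˡ c) (c≤x n h)
  diff : ∀ {p q} → 0ℚ ℚ.< p → 0ℚ ℚ.< q → invℚ p ℚ.* invℚ q ℚ.* (q ℚ.- p) ≡ invℚ p ℚ.- invℚ q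
  diff {p} {q} 0<p 0<q = trans
    (solve 4 (λ i j p q → i :* j :* (q :- p) := i :* (q :* j) :- j :* (p :* i)) refl (invℚ p) (invℚ q) p q)
    (cong₂ ℚ._-_
      (trans (cong (invℚ p ℚ.*_) (invℚ-inverseʳ 0<q)) (ℚ.*-identityʳ (invℚ p)))
      (trans (cong (invℚ q ℚ.*_) (invℚ-inverseʳ 0<p)) (ℚ.*-identityʳ (invℚ q))))
  cancel : ∀ ε → invℚ c ℚ.* invℚ c ℚ.* (c ℚ.* c ℚ.* ε) ≡ ε
  cancel ε = trans
    (solve 3 (λ i c e → i :* i :* (c :* c :* e) := (c :* i) :* ((c :* i) :* e)) refl (invℚ c) c ε)
    (trans (cong (λ u → u ℚ.* (u ℚ.* ε)) (invℚ-inverseʳ 0<c))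
      (trans (ℚ.*-identityˡ (1ℚ ℚ.* ε)) (ℚ.*-identityˡ ε)))

_÷_[_] : ℝ → (y : ℝ) → 0ℝ < y → ℝ
x ÷ y [ 0<y ] = x * inv y 0<y

-- The square root of max(x, 0); the n-th term is within 1/(n+1) of √max(xₙ, 0).
sqrt : ℝ → ℝ
sqrt x = mkℝ (λ n → sqrtℚ n (x⁺ n)) λ ε 0<ε →
  let η   = ½ ℚ.* ε
      0<η = ½*-pos 0<ε
      (N₁ , p) = cauchy x (η ℚ.* η) (*-pos 0<η 0<η)
      (N₂ , q) = archimedean 0<η
      N₁≤N = ℕ.m≤m⊔n N₁ N₂
      N₂≤N = ℕ.m≤n⊔m N₁ N₂
      half = λ m n hm hn → ℚ.≤-trans
        (sqrtℚ-close m n (0≤x⁺ m) (0≤x⁺ n) (ℚ.<⇒≤ 0<η)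
          (x⁺-close m n (ℚ.<⇒≤ (*-pos 0<η 0<η)) (p m n (ℕ.≤-trans N₁≤N hm) (ℕ.≤-trans N₁≤N hn))))
        (ℚ.+-monoʳ-≤ (sqrtℚ n (x⁺ n)) (subst (1/suc n ℚ.+ η ℚ.≤_) (½+½ ε)
          (ℚ.+-monoˡ-≤ η (q n (ℕ.≤-trans N₂≤N hn)))))
  in N₁ ℕ.⊔ N₂ , λ m n hm hn → ∣p-q∣≤r (half m n hm hn) (half n m hn hm)
  where
  x⁺ : ℕ → ℚ
  x⁺ n = seq x n ℚ.⊔ 0ℚ
  0≤x⁺ : ∀ n → 0ℚ ℚ.≤ x⁺ n
  0≤x⁺ n = ℚ.p≤q⊔p (seq x n) 0ℚ
  x⁺-close : ∀ m n {r} → 0ℚ ℚ.≤ r → ℚ.∣ seq x m ℚ.- seq x n ∣ ℚ.≤ r → x⁺ m ℚ.≤ x⁺ n ℚ.+ r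
  x⁺-close m n {r} 0≤r h = ℚ.⊔-lub
    (ℚ.≤-trans (∣p-q∣≤r⇒p≤q+r {seq x m} {seq x n} h) (ℚ.+-monoˡ-≤ r (ℚ.p≤p⊔q (seq x n) 0ℚ)))
    (subst (ℚ._≤ x⁺ n ℚ.+ r) (ℚ.+-identityˡ 0ℚ) (ℚ.+-mono-≤ (0≤x⁺ n) 0≤r))

-- The order-theoretic supremum in its constructively adequate form: the second
-- clause implies (and classically is equivalent to) z being the least upper bound.
IsSupremum : (ℝ → Set) → ℝ → Set
IsSupremum A z = (∀ v → A v → v ≤ z) × (∀ t → t < z → ∃[ v ] A v × t < v)

------------------------------------------------------------------------
-- k-objective time series search

mean : ∀ k .{{_ : ℕ.NonZero k}} → (Fin k → ℝ) → ℝ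
mean k a = fromℚ (+ 1 ℚ./ k) * foldr _+_ 0ℝ a

record PriceIntervals (k : ℕ) .{{_ : ℕ.NonTrivial k}} : Set where
  field
    m M : Fin k → ℝ
    0<m : ∀ i → 0ℝ < m i
    m≤M : ∀ i → m i ≤ M i

  private instance
    k≢0 : ℕ.NonZero k
    k≢0 = ℕ.nonTrivial⇒nonZero k

  r : Fin k → ℝ
  r i = M i ÷ m i [ 0<m i ]

  Box : (Fin k → ℝ) → Set
  Box x = ∀ i → m i ≤ x i × x i ≤ M i

  Box⇒0< : ∀ {x} → Box x → ∀ i → 0ℝ < x i
  Box⇒0< x∈Box i = <-≤-trans (0<m i) (proj₁ (x∈Box i))

  meanRatio : (x : Fin k → ℝ) → Box x → ℝ
  meanRatio x x∈Box = mean k λ i → M i ÷ x i [ Box⇒0< x∈Box i ]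

  S_f : (Fin k → ℝ) → Set
  S_f x = Σ[ x∈Box ∈ Box x ] mean k (λ i → x i ÷ m i [ 0<m i ]) ≈ meanRatio x x∈Box

  -- z is z_f: suprema need not exist constructively, so z_f is a predicate on z.
  IsCompetitiveRatio : ℝ → Set
  IsCompetitiveRatio = IsSupremum λ v →
    ∃[ x ] Σ[ x∈S ∈ S_f x ] v ≈ meanRatio x (proj₁ x∈S)

{-# OPTIONS --safe #-}
module Submission where

open import Data.Nat.Base as ℕ using (ℕ; nonTrivial)
import Data.Nat.Properties as ℕ
open import Data.Integer.Base using (+_)
open import Data.Rational.Base as ℚ using (ℚ; 0ℚ; 1ℚ; ½; _/_)
import Data.Rational.Properties as ℚ
open import Data.Rational.Solver using (module +-*-Solver)
open import Data.Fin.Patterns using (0F; 1F; 2F; 3F; 4F; 5F; 6F; 7F; 8F; 9F)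
open import Data.Fin using (Fin; #_)
open import Data.Vec.Base using (Vec; _∷_; []; map; lookup)
open import Data.Vec.Properties using (lookup-map)
open import Data.Product using (_,_; proj₁; proj₂; ∃-syntax; Σ-syntax; _×_)
open import Data.Sum.Base using (inj₁; inj₂)
open import Relation.Nullary using (¬_; yes; no; contradiction)
open import Relation.Binary.PropositionalEquality
  using (_≡_; refl; sym; trans; cong; cong₂; subst; subst₂)
open import Defs

open +-*-Solver using (solve; _:+_; _:*_; _:-_; :-_; con; _:=_; Polynomial; op; [+]; [*]; var; _:^_;
  normalise; ⟦_⟧N) renaming (⟦_⟧ to ⟦_⟧ℚ; correct to normalise-correct)

-- Put aᵢ = xᵢ/mᵢ and bᵢ = Mᵢ/xᵢ, so that aᵢ, bᵢ ≥ 1, aᵢbᵢ = rᵢ and the constraint reads Σaᵢ = Σbᵢ.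
-- Let t, w ≥ 1 be given by tw = r₃ and w − t = r₁ − r₂; here t ≥ 1 amounts to
-- r₁ − 1 ≤ (r₂ − 1) + (r₃ − 1), and solving the quadratic for t yields the square root. The
-- candidate optimum is a = (r₁, 1, t), b = (1, r₂, w), with sum T = r₁ + 1 + t = 1 + r₂ + w.
-- To see that no feasible point exceeds T, exchange a and b if necessary:
--   * if t ≤ a₃ ≤ w, then a₃ + b₃ ≤ t + w, and aᵢ + bᵢ ≤ rᵢ + 1 for i = 1, 2;
--   * if a₃ ≥ w, then b₃ ≤ t. Replacing (a₁, a₂) by (1, s) with s = a₁ + a₂ − 1 does not decrease
--     Σbᵢ, whence Σbᵢ ≤ r₁ + r₂/s + b₃. For s ≥ r₂ this is at most r₁ + 1 + t. For s ≤ r₂, if the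
--     sum were at least T then s + a₃ ≥ r₂ + w, and convexity on this segment, whose end
--     (s, a₃) = (r₂, w) is the worst, gives r₂/s + b₃ ≤ 1 + t.
-- These case splits are legitimate constructively because ≤ on the reals is ¬¬-stable.

-- Order and arithmetic of the reals

≤-by-diff : ∀ {p q r s} → p ℚ.≤ q → s ℚ.- r ≡ q ℚ.- p → r ℚ.≤ s
≤-by-diff {p} {q} {r} {s} p≤q s-r≡q-p = subst₂ ℚ._≤_
  (solve 2 (λ r p → p :+ (r :- p) := r) refl r p)
  (trans (solve 3 (λ r p q → q :+ (r :- p) := r :+ (q :- p)) refl r p q)
    (trans (cong (r ℚ.+_) (sym s-r≡q-p)) (solve 2 (λ r s → r :+ (s :- r) := s) refl r s)))
  (ℚ.+-monoˡ-≤ (r ℚ.- p) p≤q)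

p≤p+q : ∀ p {q} → 0ℚ ℚ.≤ q → p ℚ.≤ p ℚ.+ q
p≤p+q p {q} 0≤q = ≤-by-diff 0≤q (solve 2 (λ p q → (p :+ q) :- p := q :- con 0ℚ) refl p q)

eventually-≤ : ∀ {x y} → Eventually (λ n → seq x n ℚ.≤ seq y n) → x ≤ y
eventually-≤ {x} {y} (N , h) = mk≤ λ ε 0<ε → N , λ n N≤n →
  ℚ.≤-trans (h n N≤n) (p≤p+q (seq y n) (ℚ.<⇒≤ 0<ε))

pointwise-≤ : ∀ {x y} → (∀ n → seq x n ℚ.≤ seq y n) → x ≤ y
pointwise-≤ h = eventually-≤ (0 , λ n _ → h n)

≤-antisym : ∀ {x y} → x ≤ y → y ≤ x → x ≈ y
≤-antisym x≤y y≤x = mk≈ λ ε 0<ε → let (N , h) = ≤-bound x≤y ε 0<ε ∧ᵉ ≤-bound y≤x ε 0<ε in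
  N , λ n N≤n → ∣p-q∣≤r (proj₁ (h n N≤n)) (proj₂ (h n N≤n))

≈-sym : ∀ {x y} → x ≈ y → y ≈ x
≈-sym {x} {y} x≈y = mk≈ λ ε 0<ε → let (N , h) = ≈-bound x≈y ε 0<ε in
  N , λ n N≤n → subst (ℚ._≤ ε) (∣p-q∣≡∣q-p∣ (seq x n) (seq y n)) (h n N≤n)

≈⇒≤ : ∀ {x y} → x ≈ y → x ≤ y
≈⇒≤ {x} {y} x≈y = mk≤ λ ε 0<ε → let (N , h) = ≈-bound x≈y ε 0<ε in
  N , λ n N≤n → ∣p-q∣≤r⇒p≤q+r {seq x n} {seq y n} (h n N≤n)

eventually-≈ : ∀ {x y} → Eventually (λ n → seq x n ≡ seq y n) → x ≈ y
eventually-≈ (N , h) = ≤-antisym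
  (eventually-≤ (N , λ n N≤n → ℚ.≤-reflexive (h n N≤n)))
  (eventually-≤ (N , λ n N≤n → ℚ.≤-reflexive (sym (h n N≤n))))

≤-trans : ∀ {x y z} → x ≤ y → y ≤ z → x ≤ z
≤-trans {x} {y} {z} x≤y y≤z = mk≤ λ ε 0<ε →
  let (N , h) = ≤-bound x≤y (½ ℚ.* ε) (½*-pos 0<ε) ∧ᵉ ≤-bound y≤z (½ ℚ.* ε) (½*-pos 0<ε) in
  N , λ n N≤n → ≤-by-diff (ℚ.+-mono-≤ (proj₁ (h n N≤n)) (proj₂ (h n N≤n)))
    (solve 4 (λ a b c e → (c :+ e) :- a := ((b :+ con ½ :* e) :+ (c :+ con ½ :* e)) :-
        (a :+ b)) refl
      (seq x n) (seq y n) (seq z n) ε)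

≈-trans : ∀ {x y z} → x ≈ y → y ≈ z → x ≈ z
≈-trans x≈y y≈z = ≤-antisym (≤-trans (≈⇒≤ x≈y) (≈⇒≤ y≈z)) (≤-trans (≈⇒≤ (≈-sym y≈z)) (≈⇒≤
    (≈-sym x≈y)))

⅕ : ℚ
⅕ = + 1 / 5

-- Beyond `N` both sequences vary by at most `δ`, a fifth of `ε`, so one decidable comparison at `N`
-- settles every later index. If `x` exceeds `y` there by more than `3δ`, a gap of `δ` persists,
-- giving `y < x`; otherwise the excess stays within `5δ`.
≮⇒≥ : ∀ {x y} → ¬ y < x → x ≤ y
≮⇒≥ {x} {y} y≮x = mk≤ bound
  where
  bound : ∀ ε → 0ℚ ℚ.< ε → Eventually λ n → seq x n ℚ.≤ seq y n ℚ.+ ε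
  bound ε 0<ε = N , go
    where
    δ = ⅕ ℚ.* ε
    0<δ : 0ℚ ℚ.< δ
    0<δ = *-pos (ℚ.positive⁻¹ ⅕) 0<ε
    ε≡5δ : ε ≡ δ ℚ.+ δ ℚ.+ δ ℚ.+ δ ℚ.+ δ
    ε≡5δ = solve 1 (λ e → let d = con ⅕ :* e in e := d :+ d :+ d :+ d :+ d) refl ε
    N₁ = proj₁ (cauchy x δ 0<δ)
    N₂ = proj₁ (cauchy y δ 0<δ)
    N = N₁ ℕ.⊔ N₂
    x-close : ∀ m n → N ℕ.≤ m → N ℕ.≤ n → seq x m ℚ.≤ seq x n ℚ.+ δ
    x-close m n hm hn = ∣p-q∣≤r⇒p≤q+r {seq x m} {seq x n} (proj₂ (cauchy x δ 0<δ) m n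
      (ℕ.≤-trans (ℕ.m≤m⊔n N₁ N₂) hm) (ℕ.≤-trans (ℕ.m≤m⊔n N₁ N₂) hn))
    y-close : ∀ m n → N ℕ.≤ m → N ℕ.≤ n → seq y m ℚ.≤ seq y n ℚ.+ δ
    y-close m n hm hn = ∣p-q∣≤r⇒p≤q+r {seq y m} {seq y n} (proj₂ (cauchy y δ 0<δ) m n
      (ℕ.≤-trans (ℕ.m≤n⊔m N₁ N₂) hm) (ℕ.≤-trans (ℕ.m≤n⊔m N₁ N₂) hn))
    go : ∀ n → N ℕ.≤ n → seq x n ℚ.≤ seq y n ℚ.+ ε
    go n N≤n with seq x N ℚ.≤? seq y N ℚ.+ (δ ℚ.+ δ ℚ.+ δ)
    ... | yes h = ≤-by-diff
      (ℚ.+-mono-≤ h (ℚ.+-mono-≤ (x-close n N N≤n ℕ.≤-refl) (y-close N n ℕ.≤-refl N≤n)))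
      (trans (cong (λ e → seq y n ℚ.+ e ℚ.- seq x n) ε≡5δ)
        (solve 5 (λ x y X Y d → (y :+ (d :+ d :+ d :+ d :+ d)) :- x :=
          ((Y :+ (d :+ d :+ d)) :+ ((X :+ d) :+ (y :+ d))) :- (X :+ (x :+ Y)))
          refl (seq x n) (seq y n) (seq x N) (seq y N) δ))
    ... | no h = contradiction
      (mk< δ 0<δ (N , λ k N≤k → ≤-by-diff
        (ℚ.+-mono-≤ (ℚ.<⇒≤ (ℚ.≰⇒> h)) (ℚ.+-mono-≤ (x-close N k ℕ.≤-refl N≤k)
            (y-close k N N≤k ℕ.≤-refl)))
        (solve 5 (λ x y X Y d → x :- (y :+ d) :=
          (X :+ ((x :+ d) :+ (Y :+ d))) :- ((Y :+ (d :+ d :+ d)) :+ (X :+ y)))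
          refl (seq x k) (seq y k) (seq x N) (seq y N) δ)))
      y≮x

<⇒≤ : ∀ {x y} → x < y → x ≤ y
<⇒≤ {x} (mk< g 0<g (N , h)) = eventually-≤ (N , λ n N≤n →
    ℚ.≤-trans (p≤p+q (seq x n) (ℚ.<⇒≤ 0<g)) (h n N≤n))

<-irrefl : ∀ {x} → ¬ x < x
<-irrefl {x} (mk< g 0<g (N , h)) = ℚ.<-irrefl refl (ℚ.<-≤-trans 0<g g≤0)
  where
  g≤0 : g ℚ.≤ 0ℚ
  g≤0 = ≤-by-diff (h N ℕ.≤-refl) (solve 2 (λ x g → con 0ℚ :- g := x :- (x :+ g)) refl (seq x N) g)

<⇒≱ : ∀ {x y} → x < y → ¬ y ≤ x
<⇒≱ x<y y≤x = <-irrefl (<-≤-trans x<y y≤x)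

-- Suppose `b < a`. The second branch then refutes `y < x`, so `x ≤ y`, and the first branch gives
-- the contradiction.
≤-by-cases : ∀ x y {a b} → (x ≤ y → a ≤ b) → (y ≤ x → a ≤ b) → a ≤ b
≤-by-cases x y f g = ≮⇒≥ λ b<a → <⇒≱ b<a (f (≮⇒≥ λ y<x → <⇒≱ b<a (g (<⇒≤ y<x))))

≤⇒0≤ : ∀ {x y} → x ≤ y → 0ℝ ≤ y - x
≤⇒0≤ {x} {y} x≤y = mk≤ λ ε 0<ε → let (N , h) = ≤-bound x≤y ε 0<ε in
  N , λ n N≤n → ≤-by-diff (h n N≤n)
    (solve 3 (λ x y e → ((y :- x) :+ e) :- con 0ℚ := (y :+ e) :- x) refl (seq x n) (seq y n) ε)

0≤⇒≤ : ∀ {x y} → 0ℝ ≤ y - x → x ≤ y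
0≤⇒≤ {x} {y} 0≤y-x = mk≤ λ ε 0<ε → let (N , h) = ≤-bound 0≤y-x ε 0<ε in
  N , λ n N≤n → ≤-by-diff (h n N≤n)
    (solve 3 (λ x y e → (y :+ e) :- x := ((y :- x) :+ e) :- con 0ℚ) refl (seq x n) (seq y n) ε)

+-nonNeg : ∀ {x y} → 0ℝ ≤ x → 0ℝ ≤ y → 0ℝ ≤ x + y
+-nonNeg {x} {y} 0≤x 0≤y = mk≤ λ ε 0<ε →
  let (N , h) = ≤-bound 0≤x (½ ℚ.* ε) (½*-pos 0<ε) ∧ᵉ ≤-bound 0≤y (½ ℚ.* ε) (½*-pos 0<ε) in
  N , λ n N≤n → ≤-by-diff (ℚ.+-mono-≤ (proj₁ (h n N≤n)) (proj₂ (h n N≤n)))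
    (solve 3 (λ x y e → ((x :+ y) :+ e) :- con 0ℚ := ((x :+ con ½ :* e) :+ (y :+ con ½ :* e)) :-
        (con 0ℚ :+ con 0ℚ)) refl
      (seq x n) (seq y n) ε)

*-nonNegℚ : ∀ {p q} → 0ℚ ℚ.≤ p → 0ℚ ℚ.≤ q → 0ℚ ℚ.≤ p ℚ.* q
*-nonNegℚ {p} {q} 0≤p 0≤q = subst (ℚ._≤ p ℚ.* q) (ℚ.*-zeroˡ 0ℚ)
    (*-mono-≤-nonNeg ℚ.≤-refl 0≤p 0≤p 0≤q)

p≤q⇒0≤q-p : ∀ {p q} → p ℚ.≤ q → 0ℚ ℚ.≤ q ℚ.- p
p≤q⇒0≤q-p {p} {q} p≤q = ≤-by-diff p≤q (solve 2 (λ p q → (q :- p) :- con 0ℚ := q :- p) refl p q)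

+-nonNegℚ : ∀ {p q} → 0ℚ ℚ.≤ p → 0ℚ ℚ.≤ q → 0ℚ ℚ.≤ p ℚ.+ q
+-nonNegℚ {p} {q} 0≤p 0≤q = ℚ.≤-trans 0≤p (p≤p+q p 0≤q)

-- Eventually both terms are at least `-δ` and bounded in absolute value by `A` and `B`. According
-- to the sign of `p`, `pq + (A + B)δ` is written as a sum of nonnegative products, and `δ` is
-- chosen so that `(A + B)δ = ε`.
*-nonNeg : ∀ {x y} → 0ℝ ≤ x → 0ℝ ≤ y → 0ℝ ≤ x * y
*-nonNeg {x} {y} 0≤x 0≤y = mk≤ bound
  where
  bound : ∀ ε → 0ℚ ℚ.< ε → Eventually λ n → 0ℚ ℚ.≤ seq x n ℚ.* seq y n ℚ.+ ε
  bound ε 0<ε = let (N , h) = ev in N , λ n N≤n → let (a , b , c , d) = h n N≤n in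
    subst (λ e → 0ℚ ℚ.≤ seq x n ℚ.* seq y n ℚ.+ e) Cδ≡ε (go (seq x n) (seq y n) a b c d)
    where
    A = proj₁ (bounded x)
    B = proj₁ (bounded y)
    0<A = proj₁ (proj₂ (bounded x))
    0<B = proj₁ (proj₂ (bounded y))
    0<A+B : 0ℚ ℚ.< A ℚ.+ B
    0<A+B = ℚ.+-mono-< 0<A 0<B
    δ = ε ℚ.* invℚ (A ℚ.+ B)
    0<δ : 0ℚ ℚ.< δ
    0<δ = *-pos 0<ε (invℚ-pos 0<A+B)
    Cδ≡ε : (A ℚ.+ B) ℚ.* δ ≡ ε
    Cδ≡ε = trans (solve 3 (λ c e i →
        c :* (e :* i) := e :* (c :* i)) refl (A ℚ.+ B) ε (invℚ (A ℚ.+ B)))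
      (trans (cong (ε ℚ.*_) (invℚ-inverseʳ 0<A+B)) (ℚ.*-identityʳ ε))
    ev : Eventually λ n → 0ℚ ℚ.≤ seq x n ℚ.+ δ × 0ℚ ℚ.≤ seq y n ℚ.+ δ
           × ℚ.∣ seq x n ∣ ℚ.≤ A × ℚ.∣ seq y n ∣ ℚ.≤ B
    ev = ≤-bound 0≤x δ 0<δ ∧ᵉ ≤-bound 0≤y δ 0<δ ∧ᵉ proj₂ (proj₂ (bounded x)) ∧ᵉ proj₂ (proj₂
        (bounded y))
    0≤δ = ℚ.<⇒≤ 0<δ
    0≤δA = *-nonNegℚ 0≤δ (ℚ.<⇒≤ 0<A)
    0≤δB = *-nonNegℚ 0≤δ (ℚ.<⇒≤ 0<B)
    go : ∀ p q → 0ℚ ℚ.≤ p ℚ.+ δ → 0ℚ ℚ.≤ q ℚ.+ δ → ℚ.∣ p ∣ ℚ.≤ A → ℚ.∣ q ∣ ℚ.≤ B →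
      0ℚ ℚ.≤ p ℚ.* q ℚ.+ (A ℚ.+ B) ℚ.* δ
    go p q 0≤p+δ 0≤q+δ ∣p∣≤A ∣q∣≤B with ℚ.≤-total 0ℚ p
    ... | inj₁ 0≤p = subst (0ℚ ℚ.≤_)
      (solve 5 (λ p q A B d → p :* (q :+ d) :+ (d :* (A :- p) :+ d :* B) := p :* q :+
          (A :+ B) :* d) refl p q A B δ)
      (+-nonNegℚ (*-nonNegℚ 0≤p 0≤q+δ)
        (+-nonNegℚ (*-nonNegℚ 0≤δ (p≤q⇒0≤q-p (ℚ.≤-trans (p≤∣p∣ p) ∣p∣≤A))) 0≤δB))
    ... | inj₂ p≤0 = subst (0ℚ ℚ.≤_)
      (solve 5 (λ p q A B d → (con 0ℚ :- p) :* (B :- q) :+ (B :* (p :+ d) :+ d :* A) := p :* q :+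
          (A :+ B) :* d)
        refl p q A B δ)
      (+-nonNegℚ (*-nonNegℚ (p≤q⇒0≤q-p p≤0) (p≤q⇒0≤q-p (ℚ.≤-trans (p≤∣p∣ q) ∣q∣≤B)))
        (+-nonNegℚ (*-nonNegℚ (ℚ.<⇒≤ 0<B) 0≤p+δ) 0≤δA))

-- If `y ≤ -g` and `x ≥ c` eventually, then `xy ≤ -cg`, so `xy` would be negative.
*-cancel-nonNeg : ∀ {x y} → 0ℝ < x → 0ℝ ≤ x * y → 0ℝ ≤ y
*-cancel-nonNeg {x} {y} (mk< c 0<c 0+c≤x) 0≤xy = ≮⇒≥ λ (mk< g 0<g y+g≤0) →
  <⇒≱ (mk< (c ℚ.* g) (*-pos 0<c 0<g) (let (N , h) = 0+c≤x ∧ᵉ y+g≤0 in N , λ n N≤n →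
    ≤-by-diff
      (+-nonNegℚ (*-nonNegℚ (0≤c+ (h n N≤n)) (p≤q⇒0≤q-p (proj₂ (h n N≤n))))
        (*-nonNegℚ (ℚ.<⇒≤ 0<g) (p≤q⇒0≤q-p (proj₁ (h n N≤n)))))
      (solve 4 (λ x y c g → con 0ℚ :- (x :* y :+ c :* g) :=
        (x :* (con 0ℚ :- (y :+ g)) :+ g :* (x :- (con 0ℚ :+ c))) :- con 0ℚ) refl (seq x n)
            (seq y n) c g)))
    0≤xy
  where
  0≤c+ : ∀ {p} {R : Set} → 0ℚ ℚ.+ c ℚ.≤ p × R → 0ℚ ℚ.≤ p
  0≤c+ (h , _) = ℚ.≤-trans (+-nonNegℚ ℚ.≤-refl (ℚ.<⇒≤ 0<c)) h

inv-inverseʳ : ∀ {x} (0<x : 0ℝ < x) → x * inv x 0<x ≈ 1ℝ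
inv-inverseʳ (mk< c 0<c (N , h)) = eventually-≈ (N , λ n N≤n →
  invℚ-inverseʳ (ℚ.<-≤-trans (ℚ.+-mono-≤-< ℚ.≤-refl 0<c) (h n N≤n)))

inv-nonNeg : ∀ {x} (0<x : 0ℝ < x) → 0ℝ ≤ inv x 0<x
inv-nonNeg (mk< c 0<c (N , h)) = eventually-≤ (N , λ n N≤n →
  ℚ.<⇒≤ (invℚ-pos (ℚ.<-≤-trans (ℚ.+-mono-≤-< ℚ.≤-refl 0<c) (h n N≤n))))

≤-refl : ∀ {x} → x ≤ x
≤-refl {x} = pointwise-≤ {x} {x} λ _ → ℚ.≤-refl

≈-refl : ∀ {x} → x ≈ x
≈-refl {x} = eventually-≈ {x} {x} (0 , λ _ _ → refl)

*-swap : ∀ x y {z} → x * y ≈ z → y * x ≈ z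
*-swap x y {z} = ≈-trans {y * x} {x * y} {z}
  (eventually-≈ {y * x} {x * y} (0 , λ n _ → ℚ.*-comm (seq y n) (seq x n)))

*-identityʳ : ∀ x → x * 1ℝ ≈ x
*-identityʳ x = eventually-≈ {x * 1ℝ} {x} (0 , λ n _ → ℚ.*-identityʳ (seq x n))

-- Nonnegativity certificates

pow : ℝ → ℕ → ℝ
pow x 0         = 1ℝ
pow x (ℕ.suc n) = x * pow x n

-- A second semantics for the ring solver's syntax. It agrees term by term with the rational one, so
-- rational normal forms establish identities between real expressions.
⟦_⟧ : ∀ {k} → Polynomial k → Vec ℝ k → ℝ
⟦ op [+] p q ⟧ ρ = ⟦ p ⟧ ρ + ⟦ q ⟧ ρ
⟦ op [*] p q ⟧ ρ = ⟦ p ⟧ ρ * ⟦ q ⟧ ρ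
⟦ con c      ⟧ ρ = fromℚ c
⟦ var i      ⟧ ρ = lookup ρ i
⟦ p :^ n     ⟧ ρ = pow (⟦ p ⟧ ρ) n
⟦ :- p       ⟧ ρ = - ⟦ p ⟧ ρ

at : ∀ {k} → ℕ → Vec ℝ k → Vec ℚ k
at n = map (λ x → seq x n)

seq-⟦⟧ : ∀ {k} (p : Polynomial k) ρ n → seq (⟦ p ⟧ ρ) n ≡ ⟦ p ⟧ℚ (at n ρ)
seq-⟦⟧ (op [+] p q) ρ n = cong₂ ℚ._+_ (seq-⟦⟧ p ρ n) (seq-⟦⟧ q ρ n)
seq-⟦⟧ (op [*] p q) ρ n = cong₂ ℚ._*_ (seq-⟦⟧ p ρ n) (seq-⟦⟧ q ρ n)
seq-⟦⟧ (con c)      ρ n = refl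
seq-⟦⟧ (var i)      ρ n = sym (lookup-map i (λ x → seq x n) ρ)
seq-⟦⟧ (p :^ 0)     ρ n = refl
seq-⟦⟧ (p :^ ℕ.suc m) ρ n = cong₂ ℚ._*_ (seq-⟦⟧ p ρ n) (seq-⟦⟧ (p :^ m) ρ n)
seq-⟦⟧ (:- p)       ρ n = cong ℚ.-_ (seq-⟦⟧ p ρ n)

seq-normalise : ∀ {k} {p q : Polynomial k} → normalise p ≡ normalise q →
  ∀ ρ n → seq (⟦ p ⟧ ρ) n ≡ seq (⟦ q ⟧ ρ) n
seq-normalise {p = p} {q} e ρ n = trans (seq-⟦⟧ p ρ n) (trans (sym (normalise-correct p (at n ρ)))
  (trans (cong (λ N → ⟦ N ⟧N (at n ρ)) e) (trans (normalise-correct q (at n ρ)) (sym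
      (seq-⟦⟧ q ρ n)))))

*-≈-nonNeg : ∀ {x y} c → x ≈ y → 0ℝ ≤ c * (x - y)
*-≈-nonNeg {x} {y} c x≈y = ≤-by-cases 0ℝ c
  (λ 0≤c → *-nonNeg {c} {x - y} 0≤c (≤⇒0≤ {y} {x} (≈⇒≤ (≈-sym x≈y))))
  (λ c≤0 → ≤-trans (*-nonNeg {0ℝ - c} {y - x} (≤⇒0≤ {c} {0ℝ} c≤0) (≤⇒0≤ {x} {y} (≈⇒≤ x≈y)))
    (pointwise-≤ λ n → ℚ.≤-reflexive
      (solve 3 (λ c x y → (con 0ℚ :- c) :* (y :- x) := c :* (x :- y)) refl (seq c n) (seq x n)
          (seq y n))))

𝟘 𝟙 : ∀ {k} → Polynomial k
𝟘 = con 0ℚ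
𝟙 = con 1ℚ

-- Certificates are indexed by polynomial expressions rather than by the reals these denote: the
-- expressions are found by unification, and identities between them follow from equality of
-- normal forms.
module Certificates {k} (ρ : Vec ℝ k) where

  record NonNeg (p : Polynomial k) : Set where
    constructor nonNeg
    field 0≤⟦⟧ : 0ℝ ≤ ⟦ p ⟧ ρ

  open NonNeg

  infixl 6 _⊞_
  infixl 7 _⊠_

  _⊞_ : ∀ {p q} → NonNeg p → NonNeg q → NonNeg (p :+ q)
  _⊞_ {p} {q} (nonNeg 0≤p) (nonNeg 0≤q) = nonNeg (+-nonNeg {⟦ p ⟧ ρ} {⟦ q ⟧ ρ} 0≤p 0≤q)

  _⊠_ : ∀ {p q} → NonNeg p → NonNeg q → NonNeg (p :* q)
  _⊠_ {p} {q} (nonNeg 0≤p) (nonNeg 0≤q) = nonNeg (*-nonNeg {⟦ p ⟧ ρ} {⟦ q ⟧ ρ} 0≤p 0≤q)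

  -- Takes an identity between values: the normal form of an expression containing an unspecified
  -- `p` does not compute.
  nonNeg-resp : ∀ {p} q → NonNeg p → (∀ n → seq (⟦ p ⟧ ρ) n ≡ seq (⟦ q ⟧ ρ) n) → NonNeg q
  nonNeg-resp {p} q (nonNeg 0≤p) e = nonNeg (≤-trans {0ℝ} {⟦ p ⟧ ρ} {⟦ q ⟧ ρ} 0≤p
    (pointwise-≤ {⟦ p ⟧ ρ} {⟦ q ⟧ ρ} λ n → ℚ.≤-reflexive (e n)))

  renormalise : ∀ {p} q → NonNeg p → normalise p ≡ normalise q → NonNeg q
  renormalise {p} q 0≤p e = nonNeg-resp q 0≤p (seq-normalise {p = p} {q} e ρ)

  -- A real carries its Cauchy proof, and comparing two real expressions may unfold those proofs
  -- beyond reach of the type checker. Hence certificates consume and produce the bounds on the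
  -- underlying sequences, and proofs are rebuilt below as mk≤ (≤-bound h) and mk≈ (≈-bound h)
  -- wherever only the sequences should be compared.
  private
    _≤ᵖ_ _≈ᵖ_ : Polynomial k → Polynomial k → Set
    p ≤ᵖ q = ∀ ε → 0ℚ ℚ.< ε → Eventually λ n → ⟦ p ⟧ℚ (at n ρ) ℚ.≤ ⟦ q ⟧ℚ (at n ρ) ℚ.+ ε
    p ≈ᵖ q = ∀ ε → 0ℚ ℚ.< ε → Eventually λ n → ℚ.∣ ⟦ p ⟧ℚ (at n ρ) ℚ.- ⟦ q ⟧ℚ (at n ρ) ∣ ℚ.≤ ε

  inequality : ∀ p q → p ≤ᵖ q → NonNeg (q :- p)
  inequality p q h = nonNeg (mk≤ λ ε 0<ε → let (N , h′) = h ε 0<ε in N , λ n N≤n → ≤-by-diff (h′ n N≤n)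
    (trans (cong (λ v → v ℚ.+ ε ℚ.- 0ℚ) (seq-⟦⟧ (q :- p) ρ n))
      (solve 3 (λ x y e → ((y :- x) :+ e) :- con 0ℚ := (y :+ e) :- x) refl
        (⟦ p ⟧ℚ (at n ρ)) (⟦ q ⟧ℚ (at n ρ)) ε)))

  -- c may have either sign, so equations enter certificates just as nonnegative terms do.
  equation : ∀ c p q → p ≈ᵖ q → NonNeg (c :* (p :- q))
  equation c p q h = nonNeg (≤-trans {0ℝ} {⟦ c ⟧ ρ * (⟦ p ⟧ ρ - ⟦ q ⟧ ρ)} {⟦ c :* (p :- q) ⟧ ρ}
    (*-≈-nonNeg {⟦ p ⟧ ρ} {⟦ q ⟧ ρ} (⟦ c ⟧ ρ) (mk≈ λ ε 0<ε → let (N , h′) = h ε 0<ε in N , λ n N≤n →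
      subst (ℚ._≤ ε) (sym (cong₂ (λ u v →
          ℚ.∣ u ℚ.- v ∣) (seq-⟦⟧ p ρ n) (seq-⟦⟧ q ρ n))) (h′ n N≤n)))
    (pointwise-≤ {⟦ c ⟧ ρ * (⟦ p ⟧ ρ - ⟦ q ⟧ ρ)} {⟦ c :* (p :- q) ⟧ ρ} λ n → ℚ.≤-refl))

  from-nonNeg : ∀ p q → NonNeg (q :- p) → p ≤ᵖ q
  from-nonNeg p q (nonNeg h) ε 0<ε = let (N , h′) = ≤-bound h ε 0<ε in
    N , λ n N≤n → ≤-by-diff (h′ n N≤n)
      (trans (solve 3 (λ x y e → (y :+ e) :- x := ((y :- x) :+ e) :- con 0ℚ) refl
        (⟦ p ⟧ℚ (at n ρ)) (⟦ q ⟧ℚ (at n ρ)) ε)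
      (cong (λ v → v ℚ.+ ε ℚ.- 0ℚ) (sym (seq-⟦⟧ (q :- p) ρ n))))

  constant : ∀ c → {{ℚ.NonNegative c}} → NonNeg (con c)
  constant c = nonNeg (pointwise-≤ {0ℝ} {fromℚ c} λ _ → ℚ.nonNegative⁻¹ c)

  ≥1⇒nonNeg : ∀ {p} → NonNeg (p :- 𝟙) → NonNeg p
  ≥1⇒nonNeg {p} h = nonNeg-resp p (h ⊞ constant 1ℚ) λ n →
    solve 1 (λ p → (p :- con 1ℚ) :+ con 1ℚ := p) refl (seq (⟦ p ⟧ ρ) n)

  *-≥1 : ∀ {p q} → NonNeg (p :- 𝟙) → NonNeg (q :- 𝟙) → NonNeg ((p :* q) :- 𝟙)
  *-≥1 {p} {q} hp hq = nonNeg-resp ((p :* q) :- 𝟙) (hp ⊠ ≥1⇒nonNeg {q} hq ⊞ hq) λ n →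
    solve 2 (λ p q → (p :- con 1ℚ) :* q :+ (q :- con 1ℚ) := p :* q :- con 1ℚ) refl
      (seq (⟦ p ⟧ ρ) n) (seq (⟦ q ⟧ ρ) n)

  ≥1⇒0< : ∀ s → NonNeg (s :- 𝟙) → 0ℝ < ⟦ s ⟧ ρ
  ≥1⇒0< s (nonNeg h) = mk< ½ 0<½ (let (N , h′) = ≤-bound h ½ 0<½ in N , λ n N≤n →
    ≤-by-diff (h′ n N≤n)
      (solve 1 (λ s → s :- (con 0ℚ :+ con ½) := ((s :- con 1ℚ) :+ con ½) :- con 0ℚ) refl (seq
          (⟦ s ⟧ ρ) n)))

  cancel : ∀ {s q} → NonNeg (s :- 𝟙) → NonNeg (s :* q) → NonNeg q
  cancel {s} {q} 1≤s (nonNeg h) = nonNeg (*-cancel-nonNeg {⟦ s ⟧ ρ} {⟦ q ⟧ ρ} (≥1⇒0< s 1≤s) h)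

  -- Here `e` is typically a sum of products of known nonnegative terms and of multiples of
  -- equations; only its normal form has to match that of `q :- p`.
  certify : ∀ {e} p q → NonNeg e → normalise e ≡ normalise (q :- p) → p ≤ᵖ q
  certify p q 0≤e eq = from-nonNeg p q (renormalise (q :- p) 0≤e eq)

  -- For bounds that become polynomial only after clearing denominators: `s` is the cleared factor,
  -- and `s ≥ 1` lets it be cancelled.
  certify-scaled : ∀ {e s} p q → NonNeg (s :- 𝟙) → NonNeg e →
      normalise e ≡ normalise (s :* (q :- p)) → p ≤ᵖ q
  certify-scaled {s = s} p q 1≤s 0≤e eq =
      from-nonNeg p q (cancel {s} 1≤s (renormalise (s :* (q :- p)) 0≤e eq))

-- Division and ratios

-- Multiply `yz = x` by the inverse of `y`, and `y * inv y = 1` by `z`.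
÷-unique : ∀ {x y z} (0<y : 0ℝ < y) → y * z ≈ x → x ÷ y [ 0<y ] ≈ z
÷-unique {x} {y} {z} 0<y yz≈x = ≤-antisym
  (mk≤ (certify (X :* I) Z (equation I (Y :* Z) X (≈-bound yz≈x)
      ⊞ equation Z 𝟙 (Y :* I) (≈-bound (≈-sym yi≈1))) refl))
  (mk≤ (certify Z (X :* I) (equation I X (Y :* Z) (≈-bound (≈-sym yz≈x))
      ⊞ equation Z (Y :* I) 𝟙 (≈-bound yi≈1)) refl))
  where
  open Certificates (x ∷ y ∷ z ∷ inv y 0<y ∷ [])
  X = var 0F
  Y = var 1F
  Z = var 2F
  I = var 3F
  yi≈1 = inv-inverseʳ 0<y

*-÷-cancel : ∀ {x y} (0<y : 0ℝ < y) → y * (x ÷ y [ 0<y ]) ≈ x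
*-÷-cancel {x} {y} 0<y = ≤-antisym
  (mk≤ (certify (Y :* (X :* I)) X (equation X 𝟙 (Y :* I) (≈-bound (≈-sym yi≈1))) refl))
  (mk≤ (certify X (Y :* (X :* I)) (equation X (Y :* I) 𝟙 (≈-bound yi≈1)) refl))
  where
  open Certificates (x ∷ y ∷ inv y 0<y ∷ [])
  X = var 0F
  Y = var 1F
  I = var 2F
  yi≈1 = inv-inverseʳ 0<y

0<1 : 0ℝ < 1ℝ
0<1 = mk< 1ℚ (ℚ.positive⁻¹ 1ℚ) (0 , λ _ _ → ℚ.≤-refl)

1≤÷ : ∀ {x y} (0<y : 0ℝ < y) → y ≤ x → 1ℝ ≤ x ÷ y [ 0<y ]
1≤÷ {x} {y} 0<y y≤x = mk≤ (certify 𝟙 (X :* I) (inequality 𝟘 I (≤-bound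
    (inv-nonNeg 0<y)) ⊠ inequality Y X (≤-bound y≤x)
    ⊞ equation 𝟙 (Y :* I) 𝟙 (≈-bound (inv-inverseʳ 0<y))) refl)
  where
  open Certificates (x ∷ y ∷ inv y 0<y ∷ [])
  X = var 0F
  Y = var 1F
  I = var 2F

÷-*-÷ : ∀ {m x M} (0<m : 0ℝ < m) (0<x : 0ℝ < x) → (x ÷ m [ 0<m ]) * (M ÷ x [ 0<x ]) ≈ M ÷ m [ 0<m ]
÷-*-÷ {m} {x} {M} 0<m 0<x = ≤-antisym
    (mk≤ (certify (X :* Iₘ :* (Q :* Iₓ)) (Q :* Iₘ) (equation (Q :* Iₘ) 𝟙 (X :* Iₓ) (≈-bound
        (≈-sym xi≈1))) refl))
    (mk≤ (certify (Q :* Iₘ) (X :* Iₘ :* (Q :* Iₓ)) (equation (Q :* Iₘ) (X :* Iₓ) 𝟙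
        (≈-bound xi≈1)) refl))
  where
  open Certificates (x ∷ M ∷ inv m 0<m ∷ inv x 0<x ∷ [])
  X = var 0F
  Q = var 1F
  Iₘ = var 2F
  Iₓ = var 3F
  xi≈1 : x * inv x 0<x ≈ 1ℝ
  xi≈1 = inv-inverseʳ 0<x

-- Square roots

sqrt-nonNeg : ∀ x → 0ℝ ≤ sqrt x
sqrt-nonNeg x = pointwise-≤ {0ℝ} {sqrt x} λ n → 0≤sqrtℚ n (seq x n ℚ.⊔ 0ℚ)

-- The approximants have squares below `max(xₙ, 0)`, which `0 ≤ x` eventually keeps below `xₙ + ε`.
sqrt-sq≤ : ∀ {x} → 0ℝ ≤ x → sqrt x * sqrt x ≤ x
sqrt-sq≤ {x} 0≤x = mk≤ λ ε 0<ε → let (N , h) = ≤-bound 0≤x ε 0<ε in N , λ n N≤n →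
  ℚ.≤-trans (sqrtℚ-lower n (ℚ.p≤q⊔p (seq x n) 0ℚ))
    (ℚ.⊔-lub (p≤p+q (seq x n) (ℚ.<⇒≤ 0<ε)) (h n N≤n))

1/suc-cauchy : IsCauchy 1/suc
1/suc-cauchy ε 0<ε = let (N , h) = archimedean 0<ε in N , λ m n N≤m N≤n →
  ∣p-q∣≤r (close (h m N≤m) (0≤1/suc n)) (close (h n N≤n) (0≤1/suc m))
  where
  close : ∀ {p q} → p ℚ.≤ ε → 0ℚ ℚ.≤ q → p ℚ.≤ q ℚ.+ ε
  close {p} {q} p≤ε 0≤q = ℚ.≤-trans p≤ε (ℚ.≤-trans (p≤p+q ε 0≤q) (ℚ.≤-reflexive (ℚ.+-comm ε q)))

-- The error bound of the `n`-th approximant of `sqrt`, made a real so that it can occur in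
-- certificates.
infinitesimal : ℝ
infinitesimal = mkℝ 1/suc 1/suc-cauchy

infinitesimal≈0 : infinitesimal ≈ 0ℝ
infinitesimal≈0 = ≤-antisym
  (mk≤ λ ε 0<ε → let (N , h) = archimedean 0<ε in N , λ n N≤n →
    ℚ.≤-trans (h n N≤n) (ℚ.≤-reflexive (sym (ℚ.+-identityˡ ε))))
  (pointwise-≤ {0ℝ} {infinitesimal} 0≤1/suc)

-- Termwise `x ≤ (q + d)²`; the excess `d(2q + d)` vanishes because `d ≈ 0`.
sqrt-sq≥ : ∀ {x} → x ≤ sqrt x * sqrt x
sqrt-sq≥ {x} = mk≤ (certify X (Q :* Q)
  (inequality X ((Q :+ D) :* (Q :+ D)) (≤-bound x≤[q+d]²)
    ⊞ equation (:- (Q :+ Q :+ D)) D 𝟘 (≈-bound infinitesimal≈0)) refl)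
  where
  q = sqrt x
  d = infinitesimal
  x≤[q+d]² : x ≤ (q + d) * (q + d)
  x≤[q+d]² = pointwise-≤ {x} {(q + d) * (q + d)} λ n → ℚ.≤-trans (ℚ.p≤p⊔q (seq x n) 0ℚ)
    (ℚ.<⇒≤ (sqrtℚ-upper n (ℚ.p≤q⊔p (seq x n) 0ℚ)))
  open Certificates (x ∷ q ∷ d ∷ [])
  X = var 0F
  Q = var 1F
  D = var 2F

-- The upper bound

root-order : ∀ {r₁ r₂ t w} → r₂ ≤ r₁ → w + r₂ ≈ t + r₁ → t ≤ w
root-order {r₁} {r₂} {t} {w} r₂≤r₁ w+r₂≈t+r₁ =
  mk≤ (certify T W (inequality R₂ R₁ (≤-bound r₂≤r₁)
      ⊞ equation 𝟙 (W :+ R₂) (T :+ R₁) (≈-bound w+r₂≈t+r₁)) refl)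
  where
  open Certificates (r₁ ∷ r₂ ∷ t ∷ w ∷ [])
  R₁ = var 0F
  R₂ = var 1F
  T = var 2F
  W = var 3F

-- With x = a − 1 and y = a′ − 1,
-- a a′ s (r + c − b − b′) = x ((r − r′) a′ s + r′ y (s + 1)).
merge : ∀ {r r′ a a′ b b′ s c} → 0ℝ ≤ r′ → r′ ≤ r → 1ℝ ≤ a → 1ℝ ≤ a′ → 1ℝ ≤ s →
  a * b ≈ r → a′ * b′ ≈ r′ → s * c ≈ r′ → s ≈ a + a′ - 1ℝ → b + b′ ≤ r + c
merge {r} {r′} {a} {a′} {b} {b′} {s} {c} 0≤r′ r′≤r 1≤a 1≤a′ 1≤s ab≈r a′b′≈r′ sc≈r′ s≈ =
  mk≤ (certify-scaled (B :+ B′) (R :+ C)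
    (*-≥1 (*-≥1 x y) z)
    (x ⊠ (inequality R′ R (≤-bound r′≤r) ⊠ ≥1⇒nonNeg y ⊠ ≥1⇒nonNeg z
        ⊞ inequality 𝟘 R′ (≤-bound 0≤r′) ⊠ y ⊠ (≥1⇒nonNeg z ⊞ constant 1ℚ))
      ⊞ equation (A′ :* S) R (A :* B) (≈-bound (≈-sym ab≈r))
      ⊞ equation (A :* S) R′ (A′ :* B′) (≈-bound (≈-sym a′b′≈r′))
      ⊞ equation (A :* A′) (S :* C) R′ (≈-bound sc≈r′)
      ⊞ equation R′ (A :+ A′ :- 𝟙) S (≈-bound (≈-sym s≈)))
    refl)
  where
  open Certificates (r ∷ r′ ∷ a ∷ a′ ∷ b ∷ b′ ∷ s ∷ c ∷ [])
  R = var 0F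
  R′ = var 1F
  A = var 2F
  A′ = var 3F
  B = var 4F
  B′ = var 5F
  S = var 6F
  C = var 7F
  x = inequality 𝟙 A (≤-bound 1≤a)
  y = inequality 𝟙 A′ (≤-bound 1≤a′)
  z = inequality 𝟙 S (≤-bound 1≤s)

-- With y = r₂ − s, f = (s + a₃) − (r₂ + w) and f + y = a₃ − w,
-- s a₃ (1 + t − c − b₃) = (f + y) (t (r₂ − r₃) + (r₃ − a₃ + f) (1 + t)) + w f.
edge : ∀ {r₂ r₃ a₃ b₃ s c t w} → r₃ ≤ r₂ → a₃ ≤ r₃ → s ≤ r₂ → r₂ + w ≤ s + a₃ →
  1ℝ ≤ s → 1ℝ ≤ a₃ → 1ℝ ≤ t → 1ℝ ≤ w → s * c ≈ r₂ → a₃ * b₃ ≈ r₃ → t * w ≈ r₃ → c + b₃ ≤ 1ℝ + t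
edge {r₂} {r₃} {a₃} {b₃} {s} {c} {t}
    {w} r₃≤r₂ a₃≤r₃ s≤r₂ r₂+w≤s+a₃ 1≤s 1≤a₃ 1≤t 1≤w sc≈r₂ a₃b₃≈r₃ tw≈r₃ =
  mk≤ (certify-scaled (C :+ B) (𝟙 :+ T) (*-≥1 (inequality 𝟙 S (≤-bound 1≤s)) (inequality 𝟙 A
      (≤-bound 1≤a₃)))
    ((f ⊞ y) ⊠ (≥1⇒nonNeg hT ⊠ inequality R₃ R₂ (≤-bound r₃≤r₂)
        ⊞ (inequality A R₃ (≤-bound a₃≤r₃) ⊞ f) ⊠ (constant 1ℚ ⊞ ≥1⇒nonNeg hT))
      ⊞ ≥1⇒nonNeg (inequality 𝟙 W (≤-bound 1≤w)) ⊠ f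
      ⊞ equation A R₂ (S :* C) (≈-bound (≈-sym sc≈r₂))
      ⊞ equation S R₃ (A :* B) (≈-bound (≈-sym a₃b₃≈r₃))
      ⊞ equation (S :+ (A :- W)) (T :* W) R₃ (≈-bound tw≈r₃))
    refl)
  where
  open Certificates (r₂ ∷ r₃ ∷ a₃ ∷ b₃ ∷ s ∷ c ∷ t ∷ w ∷ [])
  R₂ = var 0F
  R₃ = var 1F
  A = var 2F
  B = var 3F
  S = var 4F
  C = var 5F
  T = var 6F
  W = var 7F
  y = inequality S R₂ (≤-bound s≤r₂)
  f = inequality (R₂ :+ W) (S :+ A) (≤-bound r₂+w≤s+a₃)
  hT = inequality 𝟙 T (≤-bound 1≤t)

-- Factorisations of a fluctuation ratio

-- All that the upper bound uses about one coordinate, in a form symmetric in `a = x/m` and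
-- `b = M/x`, which permits their exchange.
Factors : ℝ → ℝ → ℝ → Set
Factors r a b = 1ℝ ≤ a × 1ℝ ≤ b × a * b ≈ r

Factors-swap : ∀ {r a b} → Factors r a b → Factors r b a
Factors-swap {a = a} {b} (1≤a , 1≤b , ab≈r) = 1≤b , 1≤a , *-swap a b ab≈r

-- Expand `(a - 1)(b - 1) ≥ 0`.
Factors-sum≤ : ∀ {r a b} → Factors r a b → a + b ≤ r + 1ℝ
Factors-sum≤ {r} {a} {b} (1≤a , 1≤b , ab≈r) = mk≤ (certify (A :+ B) (R :+ 𝟙)
  (inequality 𝟙 A (≤-bound 1≤a) ⊠ inequality 𝟙 B (≤-bound 1≤b)
      ⊞ equation 𝟙 R (A :* B) (≈-bound (≈-sym ab≈r))) refl)
  where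
  open Certificates (r ∷ a ∷ b ∷ [])
  R = var 0F
  A = var 1F
  B = var 2F

Factors⇒≤ : ∀ {r a b} → Factors r a b → a ≤ r
Factors⇒≤ {r} {a} {b} (1≤a , 1≤b , ab≈r) = mk≤ (certify A R
  (≥1⇒nonNeg (inequality 𝟙 A (≤-bound 1≤a)) ⊠ inequality 𝟙 B (≤-bound 1≤b)
      ⊞ equation 𝟙 R (A :* B) (≈-bound (≈-sym ab≈r))) refl)
  where
  open Certificates (r ∷ a ∷ b ∷ [])
  R = var 0F
  A = var 1F
  B = var 2F

-- Since `ab = r = cd`, one has `a(d - b) = d(a - c)`.
factor-anti : ∀ {r a b c d} → Factors r a b → 1ℝ ≤ d → c * d ≈ r → c ≤ a → b ≤ d
factor-anti {r} {a} {b} {c} {d} (1≤a , 1≤b , ab≈r) 1≤d cd≈r c≤a =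
    mk≤ (certify-scaled B D (inequality 𝟙 A (≤-bound 1≤a))
  (≥1⇒nonNeg (inequality 𝟙 D (≤-bound 1≤d)) ⊠ inequality C A (≤-bound c≤a)
    ⊞ equation 𝟙 (C :* D) R (≈-bound cd≈r) ⊞ equation 𝟙 R (A :* B) (≈-bound (≈-sym ab≈r))) refl)
  where
  open Certificates (r ∷ a ∷ b ∷ c ∷ d ∷ [])
  R = var 0F
  A = var 1F
  B = var 2F
  C = var 3F
  D = var 4F

factor-anti′ : ∀ {r a b c d} → Factors r a b → 1ℝ ≤ d → c * d ≈ r → a ≤ c → d ≤ b
factor-anti′ {r} {a} {b} {c} {d} (1≤a , 1≤b , ab≈r) 1≤d cd≈r a≤c =
    mk≤ (certify-scaled D B (inequality 𝟙 A (≤-bound 1≤a))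
  (≥1⇒nonNeg (inequality 𝟙 D (≤-bound 1≤d)) ⊠ inequality A C (≤-bound a≤c)
    ⊞ equation 𝟙 R (C :* D) (≈-bound (≈-sym cd≈r)) ⊞ equation 𝟙 (A :* B) R (≈-bound ab≈r)) refl)
  where
  open Certificates (r ∷ a ∷ b ∷ c ∷ d ∷ [])
  R = var 0F
  A = var 1F
  B = var 2F
  C = var 3F
  D = var 4F

-- Case analysis on the third factor

module UpperBound {r₁ r₂ r₃ t w} (r₂≤r₁ : r₂ ≤ r₁) (r₃≤r₂ : r₃ ≤ r₂) (1≤r₃ : 1ℝ ≤ r₃)
  (1≤t : 1ℝ ≤ t) (tw≈r₃ : t * w ≈ r₃) (w+r₂≈t+r₁ : w + r₂ ≈ t + r₁) where

  t≤w : t ≤ w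
  t≤w = root-order {r₁} {r₂} {t} {w} r₂≤r₁ w+r₂≈t+r₁

  1≤w : 1ℝ ≤ w
  1≤w = ≤-trans 1≤t t≤w

  -- Packaged existentially so that later certificates see `s` as an atom with a defining equation.
  merged : ∀ {x y} → 1ℝ ≤ x → 1ℝ ≤ y → ∃[ s ] s ≈ x + y - 1ℝ × 1ℝ ≤ s
  merged {x} {y} 1≤x 1≤y = x + y - 1ℝ , ≈-refl {x + y - 1ℝ} ,
    mk≤ (certify 𝟙 (X :+ Y :- 𝟙) (inequality 𝟙 X (≤-bound 1≤x) ⊞ inequality 𝟙 Y (≤-bound 1≤y)) refl)
    where
    open Certificates (x ∷ y ∷ [])
    X = var 0F
    Y = var 1F

  sum≤-large′ : ∀ {a₁ a₂ a₃ b₁ b₂ b₃ s c} → Factors r₁ a₁ b₁ → Factors r₂ a₂ b₂ → Factors r₃ a₃ b₃ →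
    s ≈ a₁ + a₂ - 1ℝ → 1ℝ ≤ s → s * c ≈ r₂ →
    a₁ + a₂ + a₃ ≈ b₁ + b₂ + b₃ → w ≤ a₃ → b₁ + b₂ + b₃ ≤ r₁ + 1ℝ + t
  sum≤-large′ {a₁} {a₂} {a₃} {b₁} {b₂} {b₃} {s} {c} F₁ F₂ F₃ s≈ 1≤s sc≈r₂ Σa≈Σb w≤a₃ =
      ≤-by-cases s r₂ low-s high-s
    where
    0≤r₂ : 0ℝ ≤ r₂
    0≤r₂ = ≤-trans (<⇒≤ 0<1) (≤-trans 1≤r₃ r₃≤r₂)
    b₁+b₂≤r₁+c : b₁ + b₂ ≤ r₁ + c
    b₁+b₂≤r₁+c = merge {r₁} {r₂} {a₁} {a₂} {b₁} {b₂} {s} {c} 0≤r₂ r₂≤r₁ (proj₁ F₁) (proj₁ F₂) 1≤s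
      (proj₂ (proj₂ F₁)) (proj₂ (proj₂ F₂)) sc≈r₂ s≈
    open Certificates (r₁ ∷ r₂ ∷ r₃ ∷ t ∷ w ∷ a₁ ∷ a₂ ∷ a₃ ∷ b₁ ∷ b₂ ∷ b₃ ∷ s ∷ c ∷ [])
    R₁ = var 0F
    R₂ = var 1F
    T = var 3F
    W = var 4F
    A₁ = var 5F
    A₂ = var 6F
    A₃ = var 7F
    B₁ = var 8F
    B₂ = var 9F
    B₃ = var (# 10)
    S = var (# 11)
    C = var (# 12)
    -- By `merge`, `b₁ + b₂ ≤ r₁ + c`, so only `c + b₃` remains to be estimated.
    bound : c + b₃ ≤ 1ℝ + t → b₁ + b₂ + b₃ ≤ r₁ + 1ℝ + t
    bound h = mk≤ (certify (B₁ :+ B₂ :+ B₃) (R₁ :+ 𝟙 :+ T)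
      (inequality (B₁ :+ B₂) (R₁ :+ C) (≤-bound b₁+b₂≤r₁+c)
          ⊞ inequality (C :+ B₃) (𝟙 :+ T) (≤-bound h)) refl)
    high-s : r₂ ≤ s → b₁ + b₂ + b₃ ≤ r₁ + 1ℝ + t
    high-s r₂≤s = bound (mk≤ (certify (C :+ B₃) (𝟙 :+ T)
      (inequality C 𝟙 (≤-bound c≤1)
        ⊞ inequality B₃ T (≤-bound (factor-anti {c = w} {d = t} F₃ 1≤t (*-swap t w tw≈r₃) w≤a₃))) refl))
      where
      c≤1 : c ≤ 1ℝ
      c≤1 = mk≤ (certify-scaled C 𝟙 (inequality 𝟙 S (≤-bound 1≤s))
        (inequality R₂ S (≤-bound r₂≤s) ⊞ equation 𝟙 R₂ (S :* C) (≈-bound (≈-sym sc≈r₂))) refl)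
    low-s : s ≤ r₂ → b₁ + b₂ + b₃ ≤ r₁ + 1ℝ + t
    -- Comparing the two sides of the goal supplies, in the nontrivial case, the reverse inequality
    -- as a hypothesis for `edge`.
    low-s s≤r₂ = ≤-by-cases (b₁ + b₂ + b₃) (r₁ + 1ℝ + t) (λ h → h) λ h →
      bound (edge {r₂} {r₃} {a₃} {b₃} {s} {c} {t} {w} r₃≤r₂ (Factors⇒≤ F₃) s≤r₂ (r₂+w≤s+a₃ h) 1≤s
          (proj₁ F₃) 1≤t 1≤w sc≈r₂ (proj₂ (proj₂ F₃)) tw≈r₃)
      where
      r₂+w≤s+a₃ : r₁ + 1ℝ + t ≤ b₁ + b₂ + b₃ → r₂ + w ≤ s + a₃
      -- `s + a₃ = Σa - 1 = Σb - 1 ≥ r₁ + t = r₂ + w`.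
      r₂+w≤s+a₃ h = mk≤ (certify (R₂ :+ W) (S :+ A₃)
        (inequality (R₁ :+ 𝟙 :+ T) (B₁ :+ B₂ :+ B₃) (≤-bound h)
          ⊞ equation 𝟙 (A₁ :+ A₂ :+ A₃) (B₁ :+ B₂ :+ B₃) (≈-bound Σa≈Σb)
          ⊞ equation 𝟙 S (A₁ :+ A₂ :- 𝟙) (≈-bound s≈)
          ⊞ equation 𝟙 (T :+ R₁) (W :+ R₂) (≈-bound (≈-sym w+r₂≈t+r₁))) refl)

  sum≤-large : ∀ {a₁ a₂ a₃ b₁ b₂ b₃} → Factors r₁ a₁ b₁ → Factors r₂ a₂ b₂ → Factors r₃ a₃ b₃ →
    a₁ + a₂ + a₃ ≈ b₁ + b₂ + b₃ → w ≤ a₃ → b₁ + b₂ + b₃ ≤ r₁ + 1ℝ + t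
  sum≤-large {a₁} {a₂} {a₃} {b₁} {b₂} {b₃} F₁ F₂ F₃ Σa≈Σb w≤a₃ =
      go (merged {a₁} {a₂} (proj₁ F₁) (proj₁ F₂))
    where
    go : ∃[ s ] s ≈ a₁ + a₂ - 1ℝ × 1ℝ ≤ s → b₁ + b₂ + b₃ ≤ r₁ + 1ℝ + t
    go (s , s≈ , 1≤s) =
      sum≤-large′ {a₁} {a₂} {a₃} {b₁} {b₂} {b₃} {s} {r₂ ÷ s [ <-≤-trans 0<1 1≤s ]} F₁ F₂ F₃
        s≈ 1≤s (*-÷-cancel {r₂} {s} (<-≤-trans 0<1 1≤s)) Σa≈Σb w≤a₃

  sum≤ : ∀ {a₁ a₂ a₃ b₁ b₂ b₃} → Factors r₁ a₁ b₁ → Factors r₂ a₂ b₂ → Factors r₃ a₃ b₃ →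
    a₁ + a₂ + a₃ ≈ b₁ + b₂ + b₃ → b₁ + b₂ + b₃ ≤ r₁ + 1ℝ + t
  sum≤ {a₁} {a₂} {a₃} {b₁} {b₂} {b₃} F₁ F₂ F₃ Σa≈Σb =
    ≤-by-cases w a₃ (sum≤-large {a₁} {a₂} {a₃} {b₁} {b₂} {b₃} F₁ F₂ F₃ Σa≈Σb) λ a₃≤w →
        ≤-by-cases a₃ t low (middle a₃≤w)
    where
    low : a₃ ≤ t → b₁ + b₂ + b₃ ≤ r₁ + 1ℝ + t
    -- Exchange `a` and `b`: from `tw = r₃` and `a₃ ≤ t` follows `w ≤ b₃`, the large case for the
    -- exchanged factors.
    low a₃≤t = ≤-trans
      (≈⇒≤ {b₁ + b₂ + b₃} {a₁ + a₂ + a₃} (≈-sym {a₁ + a₂ + a₃} {b₁ + b₂ + b₃} Σa≈Σb))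
      (sum≤-large {b₁} {b₂} {b₃} {a₁} {a₂} {a₃} (Factors-swap F₁) (Factors-swap F₂) (Factors-swap F₃)
        (≈-sym {a₁ + a₂ + a₃} {b₁ + b₂ + b₃} Σa≈Σb) (factor-anti′ {c = t} {d = w} F₃ 1≤w tw≈r₃ a₃≤t))
    middle : a₃ ≤ w → t ≤ a₃ → b₁ + b₂ + b₃ ≤ r₁ + 1ℝ + t
    -- `Σb` is half of `Σa + Σb`, and `w + r₂ = t + r₁` turns half of
    -- `(r₁ + 1) + (r₂ + 1) + (t + w)` into `r₁ + 1 + t`.
    middle a₃≤w t≤a₃ = mk≤ (certify (B₁ :+ B₂ :+ B₃) (R₁ :+ 𝟙 :+ T)
      (constant ½ ⊠ (inequality (A₁ :+ B₁) (R₁ :+ 𝟙) (≤-bound (Factors-sum≤ F₁))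
          ⊞ inequality (A₂ :+ B₂) (R₂ :+ 𝟙) (≤-bound (Factors-sum≤ F₂))
        ⊞ inequality (A₃ :+ B₃) (T :+ W) (≤-bound a₃+b₃≤t+w)
        ⊞ equation 𝟙 (A₁ :+ A₂ :+ A₃) (B₁ :+ B₂ :+ B₃) (≈-bound Σa≈Σb)
        ⊞ equation 𝟙 (T :+ R₁) (W :+ R₂) (≈-bound (≈-sym w+r₂≈t+r₁)))) refl)
      where
      open Certificates (r₁ ∷ r₂ ∷ r₃ ∷ t ∷ w ∷ a₁ ∷ a₂ ∷ a₃ ∷ b₁ ∷ b₂ ∷ b₃ ∷ [])
      R₁ = var 0F
      R₂ = var 1F
      R₃ = var 2F
      T = var 3F
      W = var 4F
      A₁ = var 5F
      A₂ = var 6F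
      A₃ = var 7F
      B₁ = var 8F
      B₂ = var 9F
      B₃ = var (# 10)
      a₃+b₃≤t+w : a₃ + b₃ ≤ t + w
      -- As `tw = a₃b₃`, one has `a₃(t + w - a₃ - b₃) = (a₃ - t)(w - a₃)`.
      a₃+b₃≤t+w = mk≤ (certify-scaled (A₃ :+ B₃) (T :+ W) (inequality 𝟙 A₃ (≤-bound (proj₁ F₃)))
        (inequality T A₃ (≤-bound t≤a₃) ⊠ inequality A₃ W (≤-bound a₃≤w)
          ⊞ equation 𝟙 (T :* W) R₃ (≈-bound tw≈r₃)
          ⊞ equation 𝟙 R₃ (A₃ :* B₃) (≈-bound (≈-sym (proj₂ (proj₂ F₃))))) refl)

-- From means to sums

1/3 : ℚ
1/3 = + 1 / 3

mean⇒sum : (a b : Fin 3 → ℝ) → mean 3 a ≈ mean 3 b → a 0F + a 1F + a 2F ≈ b 0F + b 1F + b 2F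
mean⇒sum a b h = ≤-antisym
  (mk≤ (certify ΣA ΣB (equation (con (+ 3 / 1)) MB MA (≈-bound
      (≈-sym {mean 3 a} {mean 3 b} h))) refl))
  (mk≤ (certify ΣB ΣA (equation (con (+ 3 / 1)) MA MB (≈-bound h)) refl))
  where
  open Certificates (a 0F ∷ a 1F ∷ a 2F ∷ b 0F ∷ b 1F ∷ b 2F ∷ [])
  A₁ = var 0F
  A₂ = var 1F
  A₃ = var 2F
  B₁ = var 3F
  B₂ = var 4F
  B₃ = var 5F
  ΣA = A₁ :+ A₂ :+ A₃
  ΣB = B₁ :+ B₂ :+ B₃
  MA = con 1/3 :* (A₁ :+ (A₂ :+ (A₃ :+ 𝟘)))
  MB = con 1/3 :* (B₁ :+ (B₂ :+ (B₃ :+ 𝟘)))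

mean≤ : ∀ {r₁ t z v} → z ≈ fromℚ 1/3 * (r₁ + 1ℝ + t) → (b : Fin 3 → ℝ) →
  b 0F + b 1F + b 2F ≤ r₁ + 1ℝ + t → v ≈ mean 3 b → v ≤ z
mean≤ {r₁} {t} {z} {v} z≈ b Σb≤ v≈ =
  mk≤ (certify V Z
    (third ⊠ inequality (B₁ :+ B₂ :+ B₃) (R₁ :+ 𝟙 :+ T) (≤-bound Σb≤)
      ⊞ equation 𝟙 (con 1/3 :* (B₁ :+ (B₂ :+ (B₃ :+ 𝟘)))) V (≈-bound (≈-sym {v} {mean 3 b} v≈))
      ⊞ equation 𝟙 Z (con 1/3 :* (R₁ :+ 𝟙 :+ T)) (≈-bound z≈))
    refl)
  where
  open Certificates (r₁ ∷ t ∷ z ∷ v ∷ b 0F ∷ b 1F ∷ b 2F ∷ [])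
  R₁ = var 0F
  T = var 1F
  Z = var 2F
  V = var 3F
  B₁ = var 4F
  B₂ = var 5F
  B₃ = var 6F
  third = constant 1/3

feasible-sum≤ : ∀ {t w} (r a b : Fin 3 → ℝ) → r 1F ≤ r 0F → r 2F ≤ r 1F → 1ℝ ≤ r 2F → 1ℝ ≤ t →
    t * w ≈ r 2F → w + r 1F ≈ t + r 0F →
  (∀ i → 1ℝ ≤ a i) → (∀ i → 1ℝ ≤ b i) → (∀ i → a i * b i ≈ r i) →
  mean 3 a ≈ mean 3 b → b 0F + b 1F + b 2F ≤ r 0F + 1ℝ + t
feasible-sum≤ {t} {w} r a b r₂≤r₁ r₃≤r₂ 1≤r₃ 1≤t tw≈r₃ w+r₂≈ 1≤a 1≤b ab≈r h =
  UpperBound.sum≤ {r 0F} {r 1F} {r 2F} {t} {w} r₂≤r₁ r₃≤r₂ 1≤r₃ 1≤t tw≈r₃ w+r₂≈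
    {a 0F} {a 1F} {a 2F} {b 0F} {b 1F} {b 2F} (F 0F) (F 1F) (F 2F) (mean⇒sum a b h)
  where
  F : ∀ i → Factors (r i) (a i) (b i)
  F i = 1≤a i , 1≤b i , ab≈r i

feasible-mean≤ : ∀ {t w z v} (r a b : Fin 3 → ℝ) → r 1F ≤ r 0F → r 2F ≤ r 1F → 1ℝ ≤ r 2F → 1ℝ ≤ t →
    t * w ≈ r 2F → w + r 1F ≈ t + r 0F →
  z ≈ fromℚ 1/3 * (r 0F + 1ℝ + t) →
  (∀ i → 1ℝ ≤ a i) → (∀ i → 1ℝ ≤ b i) → (∀ i → a i * b i ≈ r i) →
  mean 3 a ≈ mean 3 b → v ≈ mean 3 b → v ≤ z
feasible-mean≤ {t} {w} {z} {v} r a b r₂≤r₁ r₃≤r₂ 1≤r₃ 1≤t tw≈r₃ w+r₂≈ z≈ 1≤a 1≤b ab≈r h v≈ =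
  mean≤ {r 0F} {t} {z} {v} z≈ b (feasible-sum≤ {t}
      {w} r a b r₂≤r₁ r₃≤r₂ 1≤r₃ 1≤t tw≈r₃ w+r₂≈ 1≤a 1≤b ab≈r h) v≈

-- The extremal point

discriminant-nonNeg : ∀ {r₁ r₂ r₃} → r₂ ≤ r₁ → 1ℝ ≤ r₃ →
  0ℝ ≤ fromℚ (+ 4 / 1) * r₃ + (r₁ - r₂) * (r₁ - r₂)
discriminant-nonNeg {r₁} {r₂} {r₃} r₂≤r₁ 1≤r₃ =
    mk≤ (certify 𝟘 (con (+ 4 / 1) :* R₃ :+ (R₁ :- R₂) :* (R₁ :- R₂))
  (constant (+ 4 / 1) ⊠ ≥1⇒nonNeg (inequality 𝟙 R₃ (≤-bound 1≤r₃)) ⊞ d ⊠ d) refl)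
  where
  open Certificates (r₁ ∷ r₂ ∷ r₃ ∷ [])
  R₁ = var 0F
  R₂ = var 1F
  R₃ = var 2F
  d = inequality R₂ R₁ (≤-bound r₂≤r₁)

-- The continuation receives t and w as variables, so that their definitions are never unfolded.
withRoots : ∀ {r₁ r₂ r₃ q} {A : Set} → r₂ ≤ r₁ → r₁ - 1ℝ ≤ (r₂ - 1ℝ) + (r₃ - 1ℝ) → 0ℝ ≤ q →
  q * q ≈ fromℚ (+ 4 / 1) * r₃ + (r₁ - r₂) * (r₁ - r₂) →
  (∀ t w → 1ℝ ≤ t → t * w ≈ r₃ → w + r₂ ≈ t + r₁ →
    fromℚ (+ 1 / 6) * (q + (r₁ + 1ℝ) + (r₂ + 1ℝ)) ≈ fromℚ 1/3 * (r₁ + 1ℝ + t) → A) → A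
withRoots {r₁} {r₂} {r₃} {q} r₂≤r₁ r₁-1≤ 0≤q q²≈ f = f t w
  -- With `d = r₁ - r₂`, multiplying `t - 1 = (q - d - 2)/2` by the conjugate `q + d + 2` removes
  -- the root and leaves `2(r₃ - 1 - d)`.
  (mk≤ (certify-scaled 𝟙 T
    (renormalise (Q :+ (R₁ :- R₂) :+ con (+ 2 / 1) :- 𝟙) (inequality 𝟘 Q (≤-bound 0≤q)
        ⊞ inequality R₂ R₁ (≤-bound r₂≤r₁) ⊞ constant 1ℚ) refl)
    (constant (+ 2 / 1) ⊠ inequality (R₁ :- 𝟙) ((R₂ :- 𝟙) :+ (R₃ :- 𝟙)) (≤-bound r₁-1≤)
      ⊞ equation (con ½) (Q :* Q) D (≈-bound q²≈))
    refl))
  (≤-antisym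
    (mk≤ (certify (T :* W) R₃ (equation (con (+ 1 / 4)) D (Q :* Q) (≈-bound D≈q²)) refl))
    (mk≤ (certify R₃ (T :* W) (equation (con (+ 1 / 4)) (Q :* Q) D (≈-bound q²≈)) refl)))
  (≤-antisym
    (mk≤ (certify (W :+ R₂) (T :+ R₁) (constant 0ℚ) refl))
    (mk≤ (certify (T :+ R₁) (W :+ R₂) (constant 0ℚ) refl)))
  (≤-antisym (mk≤ (certify Z Z′ (constant 0ℚ) refl)) (mk≤ (certify Z′ Z (constant 0ℚ) refl)))
  where
  -- Substituting `w = t + (r₁ - r₂)` into `tw = r₃` gives `t² + (r₁ - r₂)t = r₃`, whose
  -- discriminant is `q²`.
  t = fromℚ ½ * (q - (r₁ - r₂))
  w = fromℚ ½ * (q + (r₁ - r₂))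
  D≈q² = ≈-sym {q * q} {fromℚ (+ 4 / 1) * r₃ + (r₁ - r₂) * (r₁ - r₂)} q²≈
  open Certificates (r₁ ∷ r₂ ∷ r₃ ∷ q ∷ [])
  R₁ = var 0F
  R₂ = var 1F
  R₃ = var 2F
  Q = var 3F
  D = con (+ 4 / 1) :* R₃ :+ (R₁ :- R₂) :* (R₁ :- R₂)
  T = con ½ :* (Q :- (R₁ :- R₂))
  W = con ½ :* (Q :+ (R₁ :- R₂))
  Z = con (+ 1 / 6) :* (Q :+ (R₁ :+ 𝟙) :+ (R₂ :+ 𝟙))
  Z′ = con 1/3 :* (R₁ :+ 𝟙 :+ T)

m≤m*t : ∀ {m t} → 0ℝ ≤ m → 1ℝ ≤ t → m ≤ m * t
m≤m*t {m} {t} 0≤m 1≤t = mk≤ (certify P (P :* T) (inequality 𝟘 P (≤-bound 0≤m) ⊠ inequality 𝟙 T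
    (≤-bound 1≤t)) refl)
  where
  open Certificates (m ∷ t ∷ [])
  P = var 0F
  T = var 1F

scale-product : ∀ {m M t w} (0<m : 0ℝ < m) → t * w ≈ M ÷ m [ 0<m ] → (m * t) * w ≈ M
scale-product {m} {M} {t} {w} 0<m tw≈ = ≤-antisym
  (mk≤ (certify (P :* T :* W) Q (equation P (Q :* I) (T :* W) (≈-bound
      (≈-sym {t * w} {M ÷ m [ 0<m ]} tw≈))
    ⊞ equation Q 𝟙 (P :* I) (≈-bound (≈-sym mi≈1))) refl))
  (mk≤ (certify Q (P :* T :* W) (equation P (T :* W) (Q :* I) (≈-bound tw≈)
    ⊞ equation Q (P :* I) 𝟙 (≈-bound mi≈1)) refl))
  where
  open Certificates (m ∷ M ∷ t ∷ w ∷ inv m 0<m ∷ [])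
  P = var 0F
  Q = var 1F
  T = var 2F
  W = var 3F
  I = var 4F
  mi≈1 : m * inv m 0<m ≈ 1ℝ
  mi≈1 = inv-inverseʳ 0<m

mean≈ : ∀ {p q u s z} (c : Fin 3 → ℝ) → c 0F ≈ p → c 1F ≈ q → c 2F ≈ u →
  p + q + u ≈ s → z ≈ fromℚ 1/3 * s → mean 3 c ≈ z
mean≈ {p} {q} {u} {s} {z} c c₁≈p c₂≈q c₃≈u Σ≈s z≈ = ≤-antisym
  (mk≤ (certify MC Z (equation third P C₁ (≈-bound (≈-sym c₁≈p))
      ⊞ equation third Q C₂ (≈-bound (≈-sym c₂≈q))
    ⊞ equation third U C₃ (≈-bound (≈-sym c₃≈u))
        ⊞ equation third S (P :+ Q :+ U) (≈-bound (≈-sym {p + q + u} {s} Σ≈s))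
    ⊞ equation 𝟙 Z (third :* S) (≈-bound z≈)) refl))
  (mk≤ (certify Z MC (equation third C₁ P (≈-bound c₁≈p) ⊞ equation third C₂ Q (≈-bound c₂≈q)
    ⊞ equation third C₃ U (≈-bound c₃≈u) ⊞ equation third (P :+ Q :+ U) S (≈-bound Σ≈s)
    ⊞ equation 𝟙 (third :* S) Z (≈-bound (≈-sym {z} {fromℚ 1/3 * s} z≈))) refl))
  where
  open Certificates (c 0F ∷ c 1F ∷ c 2F ∷ p ∷ q ∷ u ∷ s ∷ z ∷ [])
  C₁ = var 0F
  C₂ = var 1F
  C₃ = var 2F
  P = var 3F
  Q = var 4F
  U = var 5F
  S = var 6F
  Z = var 7F
  third = con 1/3
  MC = con 1/3 :* (C₁ :+ (C₂ :+ (C₃ :+ 𝟘)))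

-- The equality of `Σb` and `Σa` at the extremal point.
swap-sum : ∀ {r₁ r₂ t w} → w + r₂ ≈ t + r₁ → 1ℝ + r₂ + w ≈ r₁ + 1ℝ + t
swap-sum {r₁} {r₂} {t} {w} h = ≤-antisym
  (mk≤ (certify (𝟙 :+ R₂ :+ W) (R₁ :+ 𝟙 :+ T) (equation 𝟙 (T :+ R₁) (W :+ R₂) (≈-bound
      (≈-sym {w + r₂} {t + r₁} h))) refl))
  (mk≤ (certify (R₁ :+ 𝟙 :+ T) (𝟙 :+ R₂ :+ W) (equation 𝟙 (W :+ R₂) (T :+ R₁) (≈-bound h)) refl))
  where
  open Certificates (r₁ ∷ r₂ ∷ t ∷ w ∷ [])
  R₁ = var 0F
  R₂ = var 1F
  T = var 2F
  W = var 3F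

-- The competitive ratio of given price intervals

module _ (P : PriceIntervals 3) where
  open PriceIntervals P

  value≤ : ∀ {t w z} → r 1F ≤ r 0F → r 2F ≤ r 1F → 1ℝ ≤ r 2F →
    1ℝ ≤ t → t * w ≈ r 2F → w + r 1F ≈ t + r 0F → z ≈ fromℚ 1/3 * (r 0F + 1ℝ + t) →
    ∀ v → (∃[ x ] Σ[ x∈S ∈ S_f x ] v ≈ meanRatio x (proj₁ x∈S)) → v ≤ z
  value≤ {t} {w} {z} r₂≤r₁ r₃≤r₂ 1≤r₃ 1≤t tw≈r₃ w+r₂≈ z≈ v (x , (x∈Box , Σa≈Σb) , v≈) =
    feasible-mean≤ {t} {w} {z} {v} r (λ i → x i ÷ m i [ 0<m i ]) (λ i →
        M i ÷ x i [ Box⇒0< x∈Box i ])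
      (mk≤ (≤-bound r₂≤r₁)) (mk≤ (≤-bound r₃≤r₂)) (mk≤ (≤-bound 1≤r₃)) 1≤t (mk≈ (≈-bound tw≈r₃))
          (mk≈ (≈-bound w+r₂≈)) (mk≈ (≈-bound z≈))
      (λ i → 1≤÷ {x i} {m i} (0<m i) (proj₁ (x∈Box i)))
      (λ i → 1≤÷ {M i} {x i} (Box⇒0< x∈Box i) (proj₂ (x∈Box i)))
      (λ i → mk≈ (≈-bound (÷-*-÷ {m i} {x i} {M i} (0<m i) (Box⇒0< x∈Box i))))
      (mk≈ (≈-bound Σa≈Σb)) (mk≈ (≈-bound v≈))

  -- The prices `xᵢ = mᵢaᵢ` for `a = (r₁, 1, t)`.
  extremal : ℝ → Fin 3 → ℝ
  extremal t 0F = M 0F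
  extremal t 1F = m 1F
  extremal t 2F = m 2F * t

  extremal∈Box : ∀ {t w} → 1ℝ ≤ t → 1ℝ ≤ w → t * w ≈ r 2F → Box (extremal t)
  extremal∈Box 1≤t 1≤w tw≈r₃ 0F = m≤M 0F , ≤-refl {M 0F}
  extremal∈Box 1≤t 1≤w tw≈r₃ 1F = ≤-refl {m 1F} , m≤M 1F
  extremal∈Box {t} {w} 1≤t 1≤w tw≈r₃ 2F = m₃≤ ,
    -- The upper end of the interval: `m₃t ≤ m₃tw = M₃`, since `w ≥ 1`.
    ≤-trans {m 2F * t} {(m 2F * t) * w} {M 2F} (m≤m*t {m 2F * t} {w}
        (≤-trans {0ℝ} {m 2F} {m 2F * t} (<⇒≤ (0<m 2F)) m₃≤) 1≤w)
      (≈⇒≤ {(m 2F * t) * w} {M 2F} (scale-product {m 2F} {M 2F} {t} {w} (0<m 2F) (mk≈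
          (≈-bound tw≈r₃))))
    where
    m₃≤ : m 2F ≤ m 2F * t
    m₃≤ = m≤m*t {m 2F} {t} (<⇒≤ (0<m 2F)) 1≤t

  -- The supremum is a maximum: both means at the extremal point equal `z`, which gives feasibility
  -- and a single witness for every `s < z`.
  value-attained : ∀ {t w z} → 1ℝ ≤ t → 1ℝ ≤ w → t * w ≈ r 2F → w + r 1F ≈ t + r 0F →
      z ≈ fromℚ 1/3 * (r 0F + 1ℝ + t) →
    ∀ s → s < z → ∃[ v ] (∃[ x ] Σ[ x∈S ∈ S_f x ] v ≈ meanRatio x (proj₁ x∈S)) × s < v
  value-attained {t} {w} {z} 1≤t 1≤w tw≈r₃ w+r₂≈ z≈ s s<z =
    mean 3 b , (x , (x∈Box , mk≈ (≈-bound (≈-trans {mean 3 a} {z} {mean 3 b} a≈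
        (≈-sym {mean 3 b} {z} b≈)))) , mk≈ (≈-bound (≈-refl {mean 3 b}))) ,
    <-≤-trans {s} {z} {mean 3 b} s<z (≈⇒≤ {z} {mean 3 b} (≈-sym {mean 3 b} {z} b≈))
    where
    x = extremal t
    x∈Box = extremal∈Box {t} {w} 1≤t 1≤w tw≈r₃
    a b : Fin 3 → ℝ
    a i = x i ÷ m i [ 0<m i ]
    b i = M i ÷ x i [ Box⇒0< x∈Box i ]
    h₁ : a 0F ≈ r 0F
    h₁ = mk≈ (≈-bound (≈-refl {r 0F}))
    h₂ : a 1F ≈ 1ℝ
    h₂ = mk≈ (≈-bound (÷-unique {m 1F} {m 1F} {1ℝ} (0<m 1F) (*-identityʳ (m 1F))))
    h₃ : a 2F ≈ t
    h₃ = mk≈ (≈-bound (÷-unique {m 2F * t} {m 2F} {t} (0<m 2F) (≈-refl {m 2F * t})))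
    h₄ : b 0F ≈ 1ℝ
    h₄ = mk≈ (≈-bound (÷-unique {M 0F} {M 0F} {1ℝ} (Box⇒0< x∈Box 0F) (*-identityʳ (M 0F))))
    h₅ : b 1F ≈ r 1F
    h₅ = mk≈ (≈-bound (÷-unique {M 1F} {m 1F} {r 1F} (Box⇒0< x∈Box 1F) (mk≈ (≈-bound
        (*-÷-cancel {M 1F} {m 1F} (0<m 1F))))))
    h₆ : b 2F ≈ w
    h₆ = mk≈ (≈-bound (÷-unique {M 2F} {m 2F * t} {w} (Box⇒0< x∈Box 2F)
        (scale-product {m 2F} {M 2F} {t} {w} (0<m 2F) (mk≈ (≈-bound tw≈r₃)))))
    a≈ : mean 3 a ≈ z
    a≈ = mean≈ {r 0F} {1ℝ} {t} {r 0F + 1ℝ + t} {z} a (mk≈ (≈-bound h₁)) (mk≈ (≈-bound h₂)) (mk≈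
        (≈-bound h₃))
      (≈-refl {r 0F + 1ℝ + t}) (mk≈ (≈-bound z≈))
    b≈ : mean 3 b ≈ z
    b≈ = mean≈ {1ℝ} {r 1F} {w} {r 0F + 1ℝ + t} {z} b (mk≈ (≈-bound h₄)) (mk≈ (≈-bound h₅)) (mk≈
        (≈-bound h₆))
      (mk≈ (≈-bound (swap-sum {r 0F} {r 1F} {t} {w} (mk≈ (≈-bound w+r₂≈))))) (mk≈ (≈-bound z≈))

  isCompetitiveRatio : ∀ {t w z} → r 1F ≤ r 0F → r 2F ≤ r 1F → 1ℝ ≤ r 2F →
    1ℝ ≤ t → t * w ≈ r 2F → w + r 1F ≈ t + r 0F → z ≈ fromℚ 1/3 * (r 0F + 1ℝ + t) →
    IsCompetitiveRatio z
  isCompetitiveRatio {t} {w} {z} r₂≤r₁ r₃≤r₂ 1≤r₃ 1≤t tw≈r₃ w+r₂≈ z≈ =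
    value≤ {t} {w} {z} (mk≤ (≤-bound r₂≤r₁)) (mk≤ (≤-bound r₃≤r₂)) (mk≤ (≤-bound 1≤r₃)) 1≤t
      (mk≈ (≈-bound tw≈r₃)) (mk≈ (≈-bound w+r₂≈)) (mk≈ (≈-bound z≈)) ,
    value-attained {t} {w} {z} 1≤t
      (≤-trans {1ℝ} {t} {w} 1≤t (root-order {r 0F} {r 1F} {t} {w} (mk≤ (≤-bound r₂≤r₁)) (mk≈
          (≈-bound w+r₂≈))))
      (mk≈ (≈-bound tw≈r₃)) (mk≈ (≈-bound w+r₂≈)) (mk≈ (≈-bound z≈))

  -- The square root enters as a variable `q`, known only through its sign and its square.
  isCompetitiveRatio-sqrt : ∀ {q z} → r 1F ≤ r 0F → r 2F ≤ r 1F → 1ℝ ≤ r 2F →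
      r 0F - 1ℝ ≤ (r 1F - 1ℝ) + (r 2F - 1ℝ) →
    0ℝ ≤ q → q * q ≈ fromℚ (+ 4 / 1) * r 2F + (r 0F - r 1F) * (r 0F - r 1F) →
    z ≈ fromℚ (+ 1 / 6) * (q + (r 0F + 1ℝ) + (r 1F + 1ℝ)) →
    IsCompetitiveRatio z
  isCompetitiveRatio-sqrt {q} {z} r₂≤r₁ r₃≤r₂ 1≤r₃ h 0≤q q²≈ z≈ =
    withRoots {r 0F} {r 1F} {r 2F} {q} (mk≤ (≤-bound r₂≤r₁)) (mk≤ (≤-bound h)) 0≤q (mk≈
        (≈-bound q²≈))
      λ t w 1≤t tw≈r₃ w+r₂≈ z≈′ →
        isCompetitiveRatio {t} {w} {z}
          (mk≤ (≤-bound r₂≤r₁)) (mk≤ (≤-bound r₃≤r₂)) (mk≤ (≤-bound 1≤r₃)) 1≤t (mk≈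
              (≈-bound tw≈r₃)) (mk≈ (≈-bound w+r₂≈))
          (mk≈ (≈-bound (≈-trans {z}
              {fromℚ (+ 1 / 6) * (q + (r 0F + 1ℝ) + (r 1F + 1ℝ))} {fromℚ 1/3 * (r 0F + 1ℝ + t)}
            (mk≈ (≈-bound z≈)) (mk≈ (≈-bound z≈′)))))

theorem5p2 : (P : PriceIntervals 3) →
    let open PriceIntervals P
        r₁ = r 0F
        r₂ = r 1F
        r₃ = r 2F
    in
    r₂ ≤ r₁ → r₃ ≤ r₂ → 1ℝ ≤ r₃ →
    r₁ - 1ℝ < (r₂ - 1ℝ) + (r₃ - 1ℝ) →
    IsCompetitiveRatio
      (fromℚ (+ 1 / 6) *
        (sqrt (fromℚ (+ 4 / 1) * r₃ + (r₁ - r₂) * (r₁ - r₂)) + (r₁ + 1ℝ) + (r₂ + 1ℝ)))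
theorem5p2 P r₂≤r₁ r₃≤r₂ 1≤r₃ r₁-1< =
  isCompetitiveRatio-sqrt P {sqrt D} (mk≤ (≤-bound r₂≤r₁)) (mk≤ (≤-bound r₃≤r₂)) (mk≤
      (≤-bound 1≤r₃))
    (mk≤ (≤-bound (<⇒≤ r₁-1<))) (sqrt-nonNeg D)
    -- `sqrt` computes the root of `max(D, 0)`, so its square is `D` once `0 ≤ D`.
    (mk≈ (≈-bound (≤-antisym {sqrt D * sqrt D} {D} (sqrt-sq≤ {D} 0≤D) (sqrt-sq≥ {D}))))
    (mk≈ (≈-bound (≈-refl {fromℚ (+ 1 / 6) * (sqrt D + (r 0F + 1ℝ) + (r 1F + 1ℝ))})))
  where
  open PriceIntervals P
  D : ℝ
  D = fromℚ (+ 4 / 1) * r 2F + (r 0F - r 1F) * (r 0F - r 1F)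
  0≤D : 0ℝ ≤ D
  0≤D = mk≤ (≤-bound (discriminant-nonNeg {r 0F} {r 1F} {r 2F} (mk≤ (≤-bound r₂≤r₁)) (mk≤
      (≤-bound 1≤r₃))))
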